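{- Let $n=2p^t$ with $p$ an odd prime and $t\ge 1$ an integer, and suppose $d=n^2+1$ is square-free (so $d\equiv 5\pmod 8$). Suppose $h(d)=q^r$ for some prime $q$ and integer $r\ge 2$. If $t>q^{r-1}$, then $\mathfrak{C}(k_n)\cong \mathbb{Z}_{q^r}$.
   Context: $k_n=\mathbb{Q}(\sqrt d)$, $h(d)$ is its class number and $\mathfrak{C}(k_n)$ its ideal class group. $\mathbb{Z}_{N}$ denotes the cyclic group of order $N$. -}

module Defs where

open import Algebra.Bundles using (AbelianGroup; CommutativeMonoid; CommutativeRing)
open import Algebra.Definitions using (Invertible)
open import Algebra.Morphism.Structures using (module GroupMorphisms)
import Algebra.Properties.CommutativeSemigroup as CommutativeSemigroupProperties
open import Algebra.Structures using (IsCommutativeRing)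
open import Data.Fin.Base using (Fin)
open import Data.Integer.Base as ℤ using (ℤ; +_)
import Data.Integer.Properties as ℤ
import Data.Integer.Divisibility.Signed as ℤ∣
import Data.Integer.Tactic.RingSolver as ℤSolver
open import Data.List.Base using (List; []; _∷_; _++_; map; cartesianProductWith)
open import Data.List.Membership.Propositional using (_∈_)
open import Data.List.Membership.Propositional.Properties
  using (∈-map⁺; ∈-map⁻; ∈-++⁺ˡ; ∈-++⁺ʳ; ∈-++⁻; ∈-cartesianProductWith⁺; ∈-cartesianProductWith⁻)
open import Data.List.Relation.Unary.Any using (here; there)
open import Data.Nat.Base as ℕ using (ℕ; suc)
import Data.Nat.Divisibility as ℕ∣
open import Data.Nat.GCD using (module Bézout; module GCD)
open import Data.Product.Base using (∃; ∃₂; _×_; _,_)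
open import Data.Rational.Base as ℚ using (ℚ; mkℚ; 0ℚ; 1ℚ; ↥_; ↧ₙ_)
import Data.Rational.Properties as ℚ
import Data.Rational.Unnormalised.Base as ℚᵘ
import Data.Rational.Unnormalised.Properties as ℚᵘ
open import Data.Rational.Solver using (module +-*-Solver)
open import Data.Sum.Base using (inj₁; inj₂)
open import Function.Bundles using (Bijection)
open import Level using (0ℓ; _⊔_) renaming (suc to lsuc)
open import Relation.Binary.PropositionalEquality
  using (_≡_; _≢_; refl; sym; trans; cong; cong₂; subst; isEquivalence; module ≡-Reasoning)
import Relation.Binary.PropositionalEquality as ≡
import Relation.Binary.Reasoning.Setoid as SetoidReasoning
open import Relation.Nullary.Decidable.Core using (yes; no)
open import Relation.Unary using (Pred; _⊆_; _≐_)

SquareFree : ℕ → Set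
SquareFree d = ∀ m → (m ℕ.* m) ℕ∣.∣ d → m ≡ 1

HasOrder : ∀ {a ℓ} → AbelianGroup a ℓ → ℕ → Set (a ⊔ ℓ)
HasOrder G N = Bijection (AbelianGroup.setoid G) (≡.setoid (Fin N))

infix 4 _≅_

_≅_ : ∀ {a b ℓ₁ ℓ₂} → AbelianGroup a ℓ₁ → AbelianGroup b ℓ₂ → Set (a ⊔ b ⊔ ℓ₁ ⊔ ℓ₂)
G ≅ H = ∃ (GroupMorphisms.IsGroupIsomorphism (AbelianGroup.rawGroup G) (AbelianGroup.rawGroup H))

-- The carrier is ℤ itself; passing to the quotient is done by the equality.
ℤ/_ℤ : ℕ → AbelianGroup 0ℓ 0ℓ
ℤ/ N ℤ = record
  { Carrier = ℤ
  ; _≈_ = λ i j → + N ∣ i - j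
  ; _∙_ = _+_
  ; ε = ℤ.0ℤ
  ; _⁻¹ = -_
  ; isAbelianGroup = record
    { isGroup = record
      { isMonoid = record
        { isSemigroup = record
          { isMagma = record
            { isEquivalence = record
              { refl = λ {i} → ≡⇒≈ (refl {x = i})
              ; sym = λ {i} {j} N∣ → subst (+ N ∣_) (neg i j) (∣m⇒∣-m N∣)
              ; trans = λ {i} {j} {k} N∣₁ N∣₂ → subst (+ N ∣_) (add i j k) (∣m∣n⇒∣m+n N∣₁ N∣₂) }
            ; ∙-cong = λ {i} {j} {k} {l} N∣₁ N∣₂ → subst (+ N ∣_) (add₂ i j k l) (∣m∣n⇒∣m+n N∣₁ N∣₂) }
          ; assoc = λ i j k → ≡⇒≈ (ℤ.+-assoc i j k) }
        ; identity = (λ i → ≡⇒≈ (ℤ.+-identityˡ i)) , (λ i → ≡⇒≈ (ℤ.+-identityʳ i)) }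
      ; inverse = (λ i → ≡⇒≈ (ℤ.+-inverseˡ i)) , (λ i → ≡⇒≈ (ℤ.+-inverseʳ i))
      ; ⁻¹-cong = λ {i} {j} N∣ → subst (+ N ∣_) (neg₂ i j) (∣m⇒∣-m N∣) }
    ; comm = λ i j → ≡⇒≈ (ℤ.+-comm i j) } }
  where
  open import Data.Integer.Base using (_+_; _-_; -_)
  open ℤ∣

  ≡⇒≈ : ∀ {i j} → i ≡ j → + N ∣ i - j
  ≡⇒≈ {i} refl = subst (+ N ∣_) (sym (ℤ.+-inverseʳ i)) (divides ℤ.0ℤ refl)

  neg : ∀ i j → - (i - j) ≡ j - i
  neg = ℤSolver.solve-∀

  neg₂ : ∀ i j → - (i - j) ≡ - i - - j
  neg₂ = ℤSolver.solve-∀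

  add : ∀ i j k → (i - j) + (j - k) ≡ i - k
  add = ℤSolver.solve-∀

  add₂ : ∀ i j k l → (i - j) + (k - l) ≡ (i + k) - (j + l)
  add₂ = ℤSolver.solve-∀

module IntegersInℚ where

  [_] : ℤ → ℚ
  [ k ] = k ℚ./ 1

  toℚᵘ-/ : ∀ k n → ℚ.toℚᵘ (k ℚ./ suc n) ℚᵘ.≃ ℚᵘ.mkℚᵘ k n
  toℚᵘ-/ k n = ℚ.toℚᵘ-fromℚᵘ (ℚᵘ.mkℚᵘ k n)

  []-+ : ∀ i j → [ i ℤ.+ j ] ≡ [ i ] ℚ.+ [ j ]
  []-+ i j = ℚ.toℚᵘ-injective (ℚᵘ.≃-trans (toℚᵘ-/ (i ℤ.+ j) 0) (ℚᵘ.≃-sym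
    (ℚᵘ.≃-trans (ℚ.toℚᵘ-homo-+ [ i ] [ j ]) (ℚᵘ.≃-trans (ℚᵘ.+-cong (toℚᵘ-/ i 0) (toℚᵘ-/ j 0))
      (ℚᵘ.*≡* (eq i j))))))
    where
    eq : ∀ i j → (i ℤ.* ℤ.1ℤ ℤ.+ j ℤ.* ℤ.1ℤ) ℤ.* ℤ.1ℤ ≡ (i ℤ.+ j) ℤ.* ℤ.1ℤ
    eq = ℤSolver.solve-∀

  []-* : ∀ i j → [ i ℤ.* j ] ≡ [ i ] ℚ.* [ j ]
  []-* i j = ℚ.toℚᵘ-injective (ℚᵘ.≃-trans (toℚᵘ-/ (i ℤ.* j) 0) (ℚᵘ.≃-sym
    (ℚᵘ.≃-trans (ℚ.toℚᵘ-homo-* [ i ] [ j ]) (ℚᵘ.*-cong (toℚᵘ-/ i 0) (toℚᵘ-/ j 0)))))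

  []-neg : ∀ i → [ ℤ.- i ] ≡ ℚ.- [ i ]
  []-neg i = ℚ.toℚᵘ-injective (ℚᵘ.≃-trans (toℚᵘ-/ (ℤ.- i) 0) (ℚᵘ.≃-sym
    (ℚᵘ.≃-trans (ℚ.toℚᵘ-homo‿- [ i ]) (ℚᵘ.-‿cong (toℚᵘ-/ i 0)))))

  ↥*1/↧ : ∀ r → r ≡ [ ↥ r ] ℚ.* ((+ 1) ℚ./ ↧ₙ r)
  ↥*1/↧ r@(mkℚ k n _) = ℚ.toℚᵘ-injective (ℚᵘ.≃-sym
    (ℚᵘ.≃-trans (ℚ.toℚᵘ-homo-* [ k ] ((+ 1) ℚ./ suc n))
      (ℚᵘ.≃-trans (ℚᵘ.*-cong (toℚᵘ-/ k 0) (toℚᵘ-/ (+ 1) n)) (ℚᵘ.*≡* (eq k (+ suc n))))))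
    where
    eq : ∀ k n → (k ℤ.* ℤ.1ℤ) ℤ.* n ≡ k ℤ.* (ℤ.1ℤ ℤ.* n)
    eq = ℤSolver.solve-∀

  n*1/n : ∀ n → [ + suc n ] ℚ.* ((+ 1) ℚ./ suc n) ≡ 1ℚ
  n*1/n n = ℚ.toℚᵘ-injective (ℚᵘ.≃-trans (ℚ.toℚᵘ-homo-* [ + suc n ] ((+ 1) ℚ./ suc n))
      (ℚᵘ.≃-trans (ℚᵘ.*-cong (toℚᵘ-/ (+ suc n) 0) (toℚᵘ-/ (+ 1) n)) (ℚᵘ.*≡* (eq (+ suc n)))))
    where
    eq : ∀ n → (n ℤ.* ℤ.1ℤ) ℤ.* ℤ.1ℤ ≡ ℤ.1ℤ ℤ.* (ℤ.1ℤ ℤ.* n)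
    eq = ℤSolver.solve-∀

  ℤ-gcd : ∀ i j → ∃ λ g → ∃₂ λ a b → ∃₂ λ u v →
          i ≡ a ℤ.* g × j ≡ b ℤ.* g × g ≡ u ℤ.* i ℤ.+ v ℤ.* j
  ℤ-gcd i j with Bézout.lemma ℤ.∣ i ∣ ℤ.∣ j ∣ | ℤ∣.m∣∣m∣ {i} | ℤ∣.m∣∣m∣ {j}
  ... | Bézout.result g isGCD id | ℤ∣.divides s p | ℤ∣.divides t q
    with ℤ∣.∣ᵤ⇒∣ {+ g} {i} (GCD.gcd∣m isGCD) | ℤ∣.∣ᵤ⇒∣ {+ g} {j} (GCD.gcd∣n isGCD)
  ... | ℤ∣.divides a i≡ | ℤ∣.divides b j≡ = + g , a , b , coeffs id
    where
    lemma : ∀ g x m y n → g ℕ.+ y ℕ.* n ≡ x ℕ.* m → + g ≡ + x ℤ.* + m ℤ.- + y ℤ.* + n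
    lemma g x m y n e = trans (cancel (+ g) (+ y ℤ.* + n)) (cong (ℤ._- + y ℤ.* + n)
      (trans (sym (trans (ℤ.pos-+ g (y ℕ.* n)) (cong (λ z → + g ℤ.+ z) (ℤ.pos-* y n))))
        (trans (cong +_ e) (ℤ.pos-* x m))))
      where
      cancel : ∀ g z → g ≡ (g ℤ.+ z) ℤ.- z
      cancel = ℤSolver.solve-∀

    shuffle : ∀ x s i y t j → x ℤ.* (s ℤ.* i) ℤ.- y ℤ.* (t ℤ.* j) ≡ (x ℤ.* s) ℤ.* i ℤ.+ (ℤ.- (y ℤ.* t)) ℤ.* j
    shuffle = ℤSolver.solve-∀

    shuffle′ : ∀ x s i y t j → y ℤ.* (t ℤ.* j) ℤ.- x ℤ.* (s ℤ.* i) ≡ (ℤ.- (x ℤ.* s)) ℤ.* i ℤ.+ (y ℤ.* t) ℤ.* j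
    shuffle′ = ℤSolver.solve-∀

    coeffs : Bézout.Identity g ℤ.∣ i ∣ ℤ.∣ j ∣ →
             ∃₂ λ u v → i ≡ a ℤ.* + g × j ≡ b ℤ.* + g × + g ≡ u ℤ.* i ℤ.+ v ℤ.* j
    coeffs (Bézout.+- x y e) = + x ℤ.* s , ℤ.- (+ y ℤ.* t) , i≡ , j≡ , trans (lemma g x ℤ.∣ i ∣ y ℤ.∣ j ∣ e)
      (trans (cong₂ (λ m n → + x ℤ.* m ℤ.- + y ℤ.* n) p q) (shuffle (+ x) s i (+ y) t j))
    coeffs (Bézout.-+ x y e) = ℤ.- (+ x ℤ.* s) , + y ℤ.* t , i≡ , j≡ , trans (lemma g y ℤ.∣ j ∣ x ℤ.∣ i ∣ e)
      (trans (cong₂ (λ m n → + y ℤ.* n ℤ.- + x ℤ.* m) p q) (shuffle′ (+ x) s i (+ y) t j))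

  MultipleOf : ℚ → ℚ → Set
  MultipleOf g r = ∃ λ k → r ≡ [ k ] ℚ.* g

  ℚ-gcd : ∀ r s → ∃ λ g → MultipleOf g r × MultipleOf g s × ∃₂ λ u v → g ≡ [ u ] ℚ.* r ℚ.+ [ v ] ℚ.* s
  ℚ-gcd r@(mkℚ _ m _) s@(mkℚ _ n _) with ℤ-gcd (↥ r ℤ.* + suc n) (↥ s ℤ.* + suc m)
  ... | g , a , b , u , v , p , q , e
    = [ g ] ℚ.* w , (a , multiple a r≡ p) , (b , multiple b s≡ q) , u , v , combination
    where
    open ≡-Reasoning
    open +-*-Solver
    x y w : ℚ
    x = (+ 1) ℚ./ suc m
    y = (+ 1) ℚ./ suc n
    w = x ℚ.* y

    r≡ : r ≡ [ ↥ r ℤ.* + suc n ] ℚ.* w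
    r≡ = begin
      r                                          ≡⟨ ↥*1/↧ r ⟩
      [ ↥ r ] ℚ.* x                              ≡⟨ sym (ℚ.*-identityʳ _) ⟩
      [ ↥ r ] ℚ.* x ℚ.* 1ℚ                       ≡⟨ cong ([ ↥ r ] ℚ.* x ℚ.*_) (sym (n*1/n n)) ⟩
      [ ↥ r ] ℚ.* x ℚ.* ([ + suc n ] ℚ.* y)      ≡⟨ solve 4 (λ a x n y → a :* x :* (n :* y) := a :* n :* (x :* y)) refl [ ↥ r ] x [ + suc n ] y ⟩
      [ ↥ r ] ℚ.* [ + suc n ] ℚ.* w              ≡⟨ cong (ℚ._* w) (sym ([]-* (↥ r) (+ suc n))) ⟩
      [ ↥ r ℤ.* + suc n ] ℚ.* w                  ∎

    s≡ : s ≡ [ ↥ s ℤ.* + suc m ] ℚ.* w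
    s≡ = begin
      s                                          ≡⟨ ↥*1/↧ s ⟩
      [ ↥ s ] ℚ.* y                              ≡⟨ sym (ℚ.*-identityʳ _) ⟩
      [ ↥ s ] ℚ.* y ℚ.* 1ℚ                       ≡⟨ cong ([ ↥ s ] ℚ.* y ℚ.*_) (sym (n*1/n m)) ⟩
      [ ↥ s ] ℚ.* y ℚ.* ([ + suc m ] ℚ.* x)      ≡⟨ solve 4 (λ a x n y → a :* y :* (n :* x) := a :* n :* (x :* y)) refl [ ↥ s ] x [ + suc m ] y ⟩
      [ ↥ s ] ℚ.* [ + suc m ] ℚ.* w              ≡⟨ cong (ℚ._* w) (sym ([]-* (↥ s) (+ suc m))) ⟩
      [ ↥ s ℤ.* + suc m ] ℚ.* w                  ∎

    multiple : ∀ {r i} a → r ≡ [ i ] ℚ.* w → i ≡ a ℤ.* g → r ≡ [ a ] ℚ.* ([ g ] ℚ.* w)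
    multiple a refl refl = trans (cong (ℚ._* w) ([]-* a g)) (ℚ.*-assoc [ a ] [ g ] w)

    combination : [ g ] ℚ.* w ≡ [ u ] ℚ.* r ℚ.+ [ v ] ℚ.* s
    combination = begin
      [ g ] ℚ.* w                                  ≡⟨ cong (λ z → [ z ] ℚ.* w) e ⟩
      [ u ℤ.* i ℤ.+ v ℤ.* j ] ℚ.* w                ≡⟨ cong (ℚ._* w) (trans ([]-+ (u ℤ.* i) (v ℤ.* j)) (cong₂ ℚ._+_ ([]-* u i) ([]-* v j))) ⟩
      ([ u ] ℚ.* [ i ] ℚ.+ [ v ] ℚ.* [ j ]) ℚ.* w  ≡⟨ solve 5 (λ u i v j w → (u :* i :+ v :* j) :* w := u :* (i :* w) :+ v :* (j :* w)) refl [ u ] [ i ] [ v ] [ j ] w ⟩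
      [ u ] ℚ.* ([ i ] ℚ.* w) ℚ.+ [ v ] ℚ.* ([ j ] ℚ.* w)  ≡⟨ cong₂ (λ r s → [ u ] ℚ.* r ℚ.+ [ v ] ℚ.* s) (sym r≡) (sym s≡) ⟩
      [ u ] ℚ.* r ℚ.+ [ v ] ℚ.* s                  ∎
      where
      i j : ℤ
      i = ↥ r ℤ.* + suc n
      j = ↥ s ℤ.* + suc m

  gcd-list : (P : Pred ℚ 0ℓ) → P 0ℚ → (∀ {r s} → P r → P s → P (r ℚ.+ s)) →
             (∀ k {r} → P r → P ([ k ] ℚ.* r)) →
             ∀ rs → (∀ {r} → r ∈ rs → P r) → ∃ λ g → P g × (∀ {r} → r ∈ rs → MultipleOf g r)
  gcd-list P P0 P+ P* [] _ = 0ℚ , P0 , λ ()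
  gcd-list P P0 P+ P* (r ∷ rs) P∈ with gcd-list P P0 P+ P* rs (λ p → P∈ (there p))
  ... | g , Pg , all with ℚ-gcd r g
  ... | h , r∣ , (k , g≡) , u , v , refl = h , P+ (P* u (P∈ (here refl))) (P* v Pg) ,
    λ { (here refl) → r∣
      ; (there p) → let (l , s≡) = all p in l ℤ.* k , trans s≡ (trans (cong ([ l ] ℚ.*_) g≡)
          (trans (sym (ℚ.*-assoc [ l ] [ k ] h)) (cong (ℚ._* h) (sym ([]-* l k))))) }

-- The ring structure below makes sense for every d; it is the field ℚ(√d)
-- exactly when d is not the square of a rational number.
module QuadraticField (d : ℤ) where

  infix 5 _+√_

  -- a +√ b  stands for  a + b √d.
  record ℚ√d : Set where
    constructor _+√_
    field
      re im : ℚ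

  dℚ : ℚ
  dℚ = d ℚ./ 1

  infixl 6 _+_
  infixl 7 _*_

  0# 1# : ℚ√d
  0# = 0ℚ +√ 0ℚ
  1# = 1ℚ +√ 0ℚ

  -_ : ℚ√d → ℚ√d
  - (a +√ b) = ℚ.- a +√ ℚ.- b

  _+_ _*_ : ℚ√d → ℚ√d → ℚ√d
  (a +√ b) + (a′ +√ b′) = a ℚ.+ a′ +√ b ℚ.+ b′
  (a +√ b) * (a′ +√ b′) = a ℚ.* a′ ℚ.+ dℚ ℚ.* (b ℚ.* b′) +√ a ℚ.* b′ ℚ.+ b ℚ.* a′

  +-*-isCommutativeRing : IsCommutativeRing _≡_ _+_ _*_ -_ 0# 1#
  +-*-isCommutativeRing = record
    { isRing = record
      { +-isAbelianGroup = record
        { isGroup = record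
          { isMonoid = record
            { isSemigroup = record
              { isMagma = record { isEquivalence = isEquivalence ; ∙-cong = cong₂ _+_ }
              ; assoc = λ x y z → cong₂ _+√_ (ℚ.+-assoc (re x) (re y) (re z)) (ℚ.+-assoc (im x) (im y) (im z)) }
            ; identity = (λ x → cong₂ _+√_ (ℚ.+-identityˡ (re x)) (ℚ.+-identityˡ (im x)))
                       , (λ x → cong₂ _+√_ (ℚ.+-identityʳ (re x)) (ℚ.+-identityʳ (im x))) }
          ; inverse = (λ x → cong₂ _+√_ (ℚ.+-inverseˡ (re x)) (ℚ.+-inverseˡ (im x)))
                    , (λ x → cong₂ _+√_ (ℚ.+-inverseʳ (re x)) (ℚ.+-inverseʳ (im x)))
          ; ⁻¹-cong = cong -_ }
        ; comm = λ x y → cong₂ _+√_ (ℚ.+-comm (re x) (re y)) (ℚ.+-comm (im x) (im y)) }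
      ; *-cong = cong₂ _*_
      ; *-assoc = *-assoc
      ; *-identity = *-identityˡ , λ x → trans (*-comm x 1#) (*-identityˡ x)
      ; distrib = *-distribˡ
                , λ x y z → trans (*-comm (y + z) x)
                    (trans (*-distribˡ x y z) (cong₂ _+_ (*-comm x y) (*-comm x z))) }
    ; *-comm = *-comm }
    where
    open ℚ√d
    open +-*-Solver

    *-assoc : ∀ x y z → (x * y) * z ≡ x * (y * z)
    *-assoc (a +√ b) (a′ +√ b′) (a″ +√ b″) = cong₂ _+√_
      (solve 7 (λ D a b c e f g →
          (a :* c :+ D :* (b :* e)) :* f :+ D :* ((a :* e :+ b :* c) :* g)
        := a :* (c :* f :+ D :* (e :* g)) :+ D :* (b :* (c :* g :+ e :* f)))
        refl dℚ a b a′ b′ a″ b″)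
      (solve 7 (λ D a b c e f g →
          (a :* c :+ D :* (b :* e)) :* g :+ (a :* e :+ b :* c) :* f
        := a :* (c :* g :+ e :* f) :+ b :* (c :* f :+ D :* (e :* g)))
        refl dℚ a b a′ b′ a″ b″)

    *-comm : ∀ x y → x * y ≡ y * x
    *-comm (a +√ b) (a′ +√ b′) = cong₂ _+√_
      (solve 5 (λ D a b c e → a :* c :+ D :* (b :* e) := c :* a :+ D :* (e :* b)) refl dℚ a b a′ b′)
      (solve 4 (λ a b c e → a :* e :+ b :* c := c :* b :+ e :* a) refl a b a′ b′)

    *-identityˡ : ∀ x → 1# * x ≡ x
    *-identityˡ (a +√ b) = cong₂ _+√_
      (solve 3 (λ D a b → con 1ℚ :* a :+ D :* (con 0ℚ :* b) := a) refl dℚ a b)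
      (solve 2 (λ a b → con 1ℚ :* b :+ con 0ℚ :* a := b) refl a b)

    *-distribˡ : ∀ x y z → x * (y + z) ≡ x * y + x * z
    *-distribˡ (a +√ b) (a′ +√ b′) (a″ +√ b″) = cong₂ _+√_
      (solve 7 (λ D a b c e f g →
          a :* (c :+ f) :+ D :* (b :* (e :+ g))
        := (a :* c :+ D :* (b :* e)) :+ (a :* f :+ D :* (b :* g)))
        refl dℚ a b a′ b′ a″ b″)
      (solve 6 (λ a b c e f g →
          a :* (e :+ g) :+ b :* (c :+ f) := (a :* e :+ b :* c) :+ (a :* g :+ b :* f))
        refl a b a′ b′ a″ b″)

  +-*-commutativeRing : CommutativeRing 0ℓ 0ℓ
  +-*-commutativeRing = record { isCommutativeRing = +-*-isCommutativeRing }

  open CommutativeRing +-*-commutativeRing using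
    (*-comm; *-assoc; *-identityˡ; *-identityʳ; distribˡ; zeroʳ; -‿inverseˡ; *-commutativeSemigroup)
  open CommutativeSemigroupProperties *-commutativeSemigroup using (x∙yz≈y∙xz)
    renaming (interchange to *-interchange)

  fromℤ : ℤ → ℚ√d
  fromℤ k = k ℚ./ 1 +√ 0ℚ

  -- monicValue (c₀ ∷ … ∷ cₘ₋₁ ∷ []) x = c₀ + c₁ x + … + cₘ₋₁ xᵐ⁻¹ + xᵐ, by Horner's rule.
  monicValue : List ℤ → ℚ√d → ℚ√d
  monicValue [] x = 1#
  monicValue (c ∷ cs) x = fromℤ c + x * monicValue cs x

  -- The ring of integers of ℚ(√d).
  Integral : Pred ℚ√d 0ℓ
  Integral x = ∃ λ cs → monicValue cs x ≡ 0#

  -- Submodules of ℚ(√d) over the ring of integers.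
  record IsSubmodule (I : Pred ℚ√d 0ℓ) : Set where
    field
      0∈       : I 0#
      +-closed : ∀ {x y} → I x → I y → I (x + y)
      ·-closed : ∀ {a x} → Integral a → I x → I (a * x)

  open IsSubmodule

  data Span (S : Pred ℚ√d 0ℓ) : Pred ℚ√d 0ℓ where
    gen    : ∀ {x} → S x → Span S x
    zero   : Span S 0#
    add    : ∀ {x y} → Span S x → Span S y → Span S (x + y)
    scalar : ∀ {a x} → Integral a → Span S x → Span S (a * x)

  Span-isSubmodule : ∀ {S} → IsSubmodule (Span S)
  Span-isSubmodule = record { 0∈ = zero ; +-closed = add ; ·-closed = scalar }

  Span-least : ∀ {S I} → IsSubmodule I → S ⊆ I → Span S ⊆ I
  Span-least M S⊆I (gen s) = S⊆I s
  Span-least M S⊆I zero = 0∈ M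
  Span-least M S⊆I (add p q) = +-closed M (Span-least M S⊆I p) (Span-least M S⊆I q)
  Span-least M S⊆I (scalar a p) = ·-closed M a (Span-least M S⊆I p)

  infixl 7 _·_
  infixr 8 _⊙_

  _·_ : Pred ℚ√d 0ℓ → Pred ℚ√d 0ℓ → Pred ℚ√d 0ℓ
  I · J = Span λ z → ∃₂ λ x y → I x × J y × z ≡ x * y

  -- The ring of integers, as a fractional ideal.
  unitIdeal : Pred ℚ√d 0ℓ
  unitIdeal = Span (_≡ 1#)

  _⊙_ : ℚ√d → Pred ℚ√d 0ℓ → Pred ℚ√d 0ℓ
  (x ⊙ I) z = ∃ λ y → I y × z ≡ x * y

  -- Every nonzero fractional ideal of a ring of integers is invertible
  -- (proved for quadratic fields at the end), so these are all of them.  Conversely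
  -- an invertible submodule is nonzero and finitely generated: if 1 = Σ xᵢ yᵢ
  -- with xᵢ in the ideal and yᵢ in the inverse, then the xᵢ generate.
  record FractionalIdeal : Set₁ where
    field
      ideal inverse         : Pred ℚ√d 0ℓ
      ideal-isSubmodule     : IsSubmodule ideal
      inverse-isSubmodule   : IsSubmodule inverse
      ideal·inverse         : ideal · inverse ≐ unitIdeal

  open FractionalIdeal

  -- I and J differ by the principal fractional ideal generated by x ∈ ℚ(√d)ˣ.
  _∼_ : FractionalIdeal → FractionalIdeal → Set
  I ∼ J = ∃ λ x → Invertible _≡_ 1# _*_ x × ideal I ≐ x ⊙ ideal J

  private
    variable
      I I′ J J′ L : Pred ℚ√d 0ℓ

  ≐-refl : I ≐ I
  ≐-refl = (λ p → p) , (λ p → p)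

  ≐-sym : I ≐ J → J ≐ I
  ≐-sym (f , g) = g , f

  ≐-trans : I ≐ J → J ≐ L → I ≐ L
  ≐-trans (f , g) (f′ , g′) = (λ p → f′ (f p)) , (λ p → g (g′ p))

  -- To map x · J into L for a fixed x it suffices to do so on generators.
  colon : IsSubmodule L → ∀ x → IsSubmodule (λ y → L (x * y))
  colon {L} M x = record
    { 0∈ = subst L (sym (zeroʳ x)) (0∈ M)
    ; +-closed = λ {y} {z} p q → subst L (sym (distribˡ x y z)) (+-closed M p q)
    ; ·-closed = λ {a} {y} i p → subst L (x∙yz≈y∙xz a x y) (·-closed M i p) }

  ·-least : IsSubmodule L → (∀ {x y} → I x → J y → L (x * y)) → I · J ⊆ L
  ·-least M f = Span-least M λ { (x , y , p , q , refl) → f p q }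

  gen· : ∀ {x y} → I x → J y → (I · J) (x * y)
  gen· {x = x} {y} p q = gen (x , y , p , q , refl)

  ·-mono : I ⊆ I′ → J ⊆ J′ → I · J ⊆ I′ · J′
  ·-mono f g = ·-least Span-isSubmodule λ p q → gen· (f p) (g q)

  ·-cong : I ≐ I′ → J ≐ J′ → I · J ≐ I′ · J′
  ·-cong (f , f′) (g , g′) = ·-mono f g , ·-mono f′ g′

  ·-comm⊆ : I · J ⊆ J · I
  ·-comm⊆ {I} {J} = ·-least Span-isSubmodule λ {x} {y} p q → subst (J · I) (*-comm y x) (gen· q p)

  ·-comm : I · J ≐ J · I
  ·-comm = ·-comm⊆ , ·-comm⊆

  ·-assocʳ⊆ : I · (J · L) ⊆ (I · J) · L
  ·-assocʳ⊆ {I} {J} {L} = ·-least Span-isSubmodule λ {x} p →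
    ·-least (colon Span-isSubmodule x) λ {y} {z} q r →
      subst ((I · J) · L) (*-assoc x y z) (gen· (gen· p q) r)

  ·-assoc : (I · J) · L ≐ I · (J · L)
  ·-assoc = (λ p → ·-mono (λ q → q) ·-comm⊆ (·-comm⊆ (·-assocʳ⊆ (·-mono (λ q → q) ·-comm⊆ (·-comm⊆ p)))))
          , ·-assocʳ⊆

  ·-identityʳ : IsSubmodule I → I · unitIdeal ≐ I
  ·-identityʳ {I} M
    = ·-least M (λ {x} p → Span-least (colon M x) λ { refl → subst I (sym (*-identityʳ x)) p })
    , λ {x} p → subst (I · unitIdeal) (*-identityʳ x) (gen· p (gen refl))

  ·-identityˡ : IsSubmodule I → unitIdeal · I ≐ I
  ·-identityˡ M = ≐-trans ·-comm (·-identityʳ M)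

  interchange : (I · J) · (I′ · J′) ≐ (I · I′) · (J · J′)
  interchange = ≐-trans ·-assoc (≐-trans (·-cong ≐-refl
    (≐-trans (≐-sym ·-assoc) (≐-trans (·-cong ·-comm ≐-refl) ·-assoc))) (≐-sym ·-assoc))

  ⊙-isSubmodule : ∀ x → IsSubmodule I → IsSubmodule (x ⊙ I)
  ⊙-isSubmodule x M = record
    { 0∈ = 0# , 0∈ M , sym (zeroʳ x)
    ; +-closed = λ { (y , p , refl) (z , q , refl) → y + z , +-closed M p q , sym (distribˡ x y z) }
    ; ·-closed = λ { {a} i (y , p , refl) → a * y , ·-closed M i p , x∙yz≈y∙xz a x y } }

  ⊙-cong : ∀ x → I ≐ J → x ⊙ I ≐ x ⊙ J
  ⊙-cong x (f , g) = (λ (y , p , e) → y , f p , e) , (λ (y , p , e) → y , g p , e)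

  ⊙-assoc : ∀ x y → (x * y) ⊙ I ≐ x ⊙ y ⊙ I
  ⊙-assoc x y = (λ { (z , p , refl) → y * z , (z , p , refl) , *-assoc x y z })
              , (λ { (_ , (z , p , refl) , refl) → z , p , sym (*-assoc x y z) })

  ⊙-identity : 1# ⊙ I ≐ I
  ⊙-identity {I} = (λ { (z , p , refl) → subst I (sym (*-identityˡ z)) p })
                 , (λ {z} p → z , p , sym (*-identityˡ z))

  ⊙-· : ∀ x → (x ⊙ I) · J ≐ x ⊙ (I · J)
  ⊙-· {I} {J} x
    = ·-least (⊙-isSubmodule x Span-isSubmodule)
        (λ { {y = y} (z , p , refl) q → z * y , gen· p q , *-assoc x z y })
    , λ { (z , p , refl) → Span-least (colon Span-isSubmodule x)
            (λ { (y , w , q , r , refl) → subst ((x ⊙ I) · J) (*-assoc x y w) (gen· (y , q , refl) r) }) p }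

  ·-⊙ : ∀ x → I · (x ⊙ J) ≐ x ⊙ (I · J)
  ·-⊙ x = ≐-trans ·-comm (≐-trans (⊙-· x) (⊙-cong x ·-comm))

  Unit : ℚ√d → Set
  Unit = Invertible _≡_ 1# _*_

  1-unit : Unit 1#
  1-unit = 1# , *-identityˡ 1# , *-identityˡ 1#

  *-unit : ∀ {x y} → Unit x → Unit y → Unit (x * y)
  *-unit {x} {y} (x′ , l , r) (y′ , l′ , r′)
    = x′ * y′
    , trans (*-interchange x′ y′ x y) (trans (cong₂ _*_ l l′) (*-identityˡ 1#))
    , trans (*-interchange x y x′ y′) (trans (cong₂ _*_ r r′) (*-identityˡ 1#))

  ≐⇒∼ : ∀ A B → ideal A ≐ ideal B → A ∼ B
  ≐⇒∼ A B e = 1# , 1-unit , ≐-trans e (≐-sym ⊙-identity)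

  ∼-sym : ∀ {A B} → A ∼ B → B ∼ A
  ∼-sym {A} {B} (x , (x′ , l , r) , e) = x′ , (x , r , l) ,
    ≐-trans (≐-sym ⊙-identity)
      (≐-trans (subst (λ u → (u ⊙ ideal B) ≐ (x′ ⊙ x ⊙ ideal B)) l (⊙-assoc x′ x))
        (⊙-cong x′ (≐-sym e)))

  _∙_ : FractionalIdeal → FractionalIdeal → FractionalIdeal
  A ∙ B = record
    { ideal = ideal A · ideal B
    ; inverse = inverse A · inverse B
    ; ideal-isSubmodule = Span-isSubmodule
    ; inverse-isSubmodule = Span-isSubmodule
    ; ideal·inverse = ≐-trans interchange
        (≐-trans (·-cong (ideal·inverse A) (ideal·inverse B)) (·-identityʳ Span-isSubmodule)) }

  1ᴵ : FractionalIdeal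
  1ᴵ = record
    { ideal = unitIdeal
    ; inverse = unitIdeal
    ; ideal-isSubmodule = Span-isSubmodule
    ; inverse-isSubmodule = Span-isSubmodule
    ; ideal·inverse = ·-identityʳ Span-isSubmodule }

  _⁻¹ : FractionalIdeal → FractionalIdeal
  A ⁻¹ = record
    { ideal = inverse A
    ; inverse = ideal A
    ; ideal-isSubmodule = inverse-isSubmodule A
    ; inverse-isSubmodule = ideal-isSubmodule A
    ; ideal·inverse = ≐-trans ·-comm (ideal·inverse A) }

  classMonoid : CommutativeMonoid (lsuc 0ℓ) 0ℓ
  classMonoid = record
    { Carrier = FractionalIdeal
    ; _≈_ = _∼_
    ; _∙_ = _∙_
    ; ε = 1ᴵ
    ; isCommutativeMonoid = record
      { isMonoid = record
        { isSemigroup = record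
          { isMagma = record
            { isEquivalence = record
              { refl = λ {A} → ≐⇒∼ A A ≐-refl
              ; sym = λ {A} {B} → ∼-sym {A} {B}
              ; trans = λ { (x , u , e) (y , v , f) → x * y , *-unit u v ,
                  ≐-trans e (≐-trans (⊙-cong x f) (≐-sym (⊙-assoc x y))) } }
            ; ∙-cong = λ { (x , u , e) (y , v , f) → x * y , *-unit u v ,
                ≐-trans (·-cong e f) (≐-trans (⊙-· x) (≐-trans (⊙-cong x (·-⊙ y)) (≐-sym (⊙-assoc x y)))) } }
          ; assoc = λ A B C → ≐⇒∼ ((A ∙ B) ∙ C) (A ∙ (B ∙ C)) ·-assoc }
        ; identity = (λ A → ≐⇒∼ (1ᴵ ∙ A) A (·-identityˡ (ideal-isSubmodule A)))
                   , (λ A → ≐⇒∼ (A ∙ 1ᴵ) A (·-identityʳ (ideal-isSubmodule A))) }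
      ; comm = λ A B → ≐⇒∼ (A ∙ B) (B ∙ A) ·-comm } }

  ClassGroup : AbelianGroup (lsuc 0ℓ) 0ℓ
  ClassGroup = record
    { Carrier = FractionalIdeal
    ; _≈_ = _∼_
    ; _∙_ = _∙_
    ; ε = 1ᴵ
    ; _⁻¹ = _⁻¹
    ; isAbelianGroup = record
      { isGroup = record
        { isMonoid = isMonoid
        ; inverse = inverseˡ , inverseʳ
        ; ⁻¹-cong = λ {A} {B} → ⁻¹-cong {A} {B} }
      ; comm = comm } }
    where
    open CommutativeMonoid classMonoid using (isMonoid; comm; setoid; ∙-cong; assoc; identityˡ; identityʳ)
      renaming (refl to ∼-refl)
    open SetoidReasoning setoid

    inverseʳ : ∀ A → (A ∙ (A ⁻¹)) ∼ 1ᴵ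
    inverseʳ A = ≐⇒∼ (A ∙ (A ⁻¹)) 1ᴵ (ideal·inverse A)

    inverseˡ : ∀ A → ((A ⁻¹) ∙ A) ∼ 1ᴵ
    inverseˡ A = ≐⇒∼ ((A ⁻¹) ∙ A) 1ᴵ (ideal·inverse (A ⁻¹))

    ⁻¹-cong : ∀ {A B} → A ∼ B → (A ⁻¹) ∼ (B ⁻¹)
    ⁻¹-cong {A} {B} A∼B = begin
      A ⁻¹                  ≈⟨ ∼-sym {(A ⁻¹) ∙ 1ᴵ} {A ⁻¹} (identityʳ (A ⁻¹)) ⟩
      (A ⁻¹) ∙ 1ᴵ           ≈⟨ ∙-cong {A ⁻¹} {A ⁻¹} {1ᴵ} {B ∙ (B ⁻¹)} (∼-refl {A ⁻¹})
                                 (∼-sym {B ∙ (B ⁻¹)} {1ᴵ} (inverseʳ B)) ⟩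
      (A ⁻¹) ∙ (B ∙ (B ⁻¹)) ≈⟨ ∼-sym {((A ⁻¹) ∙ B) ∙ (B ⁻¹)} {(A ⁻¹) ∙ (B ∙ (B ⁻¹))} (assoc (A ⁻¹) B (B ⁻¹)) ⟩
      ((A ⁻¹) ∙ B) ∙ (B ⁻¹) ≈⟨ ∙-cong {(A ⁻¹) ∙ B} {(A ⁻¹) ∙ A} {B ⁻¹} {B ⁻¹}
                                 (∙-cong {A ⁻¹} {A ⁻¹} {B} {A} (∼-refl {A ⁻¹}) (∼-sym {A} {B} A∼B)) (∼-refl {B ⁻¹}) ⟩
      ((A ⁻¹) ∙ A) ∙ (B ⁻¹) ≈⟨ ∙-cong {(A ⁻¹) ∙ A} {1ᴵ} {B ⁻¹} {B ⁻¹} (inverseˡ A) (∼-refl {B ⁻¹}) ⟩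
      1ᴵ ∙ (B ⁻¹)           ≈⟨ identityˡ (B ⁻¹) ⟩
      B ⁻¹                  ∎

  -- h(d) = N.
  ClassNumber : ℕ → Set₁
  ClassNumber N = HasOrder ClassGroup N

  open IntegersInℚ
  open ℚ√d
  open ≡-Reasoning

  ι : ℚ → ℚ√d
  ι r = r +√ 0ℚ

  conj : ℚ√d → ℚ√d
  conj (a +√ b) = a +√ ℚ.- b

  norm : ℚ√d → ℚ
  norm (a +√ b) = a ℚ.* a ℚ.- dℚ ℚ.* (b ℚ.* b)

  -- The trace of x times the conjugate of y.
  pairing : ℚ√d → ℚ√d → ℚ
  pairing (a +√ b) (a′ +√ b′) = t ℚ.+ t
    where t = a ℚ.* a′ ℚ.- dℚ ℚ.* (b ℚ.* b′)

  ι-* : ∀ r s → ι (r ℚ.* s) ≡ ι r * ι s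
  ι-* r s = cong₂ _+√_
    (solve 3 (λ D r s → r :* s := r :* s :+ D :* (con 0ℚ :* con 0ℚ)) refl dℚ r s)
    (solve 2 (λ r s → con 0ℚ := r :* con 0ℚ :+ con 0ℚ :* s) refl r s)
    where open +-*-Solver

  x*conj-x : ∀ x → x * conj x ≡ ι (norm x)
  x*conj-x (a +√ b) = cong₂ _+√_
    (solve 3 (λ D a b → a :* a :+ D :* (b :* (:- b)) := a :* a :- D :* (b :* b)) refl dℚ a b)
    (solve 2 (λ a b → a :* (:- b) :+ b :* a := con 0ℚ) refl a b)
    where open +-*-Solver

  x*conj-y+y*conj-x : ∀ x y → x * conj y + y * conj x ≡ ι (pairing x y)
  x*conj-y+y*conj-x (a +√ b) (a′ +√ b′) = cong₂ _+√_
    (solve 5 (λ D a b c e →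
        (a :* c :+ D :* (b :* (:- e))) :+ (c :* a :+ D :* (e :* (:- b)))
      := (a :* c :- D :* (b :* e)) :+ (a :* c :- D :* (b :* e)))
      refl dℚ a b a′ b′)
    (solve 4 (λ a b c e → (a :* (:- e) :+ b :* c) :+ (c :* (:- b) :+ e :* a) := con 0ℚ) refl a b a′ b′)
    where open +-*-Solver

  fromℤ-integral : ∀ k → Integral (fromℤ k)
  fromℤ-integral k = ℤ.- k ∷ [] , (begin
    fromℤ (ℤ.- k) + fromℤ k * 1#  ≡⟨ cong₂ _+_ (cong ι ([]-neg k)) (*-identityʳ (fromℤ k)) ⟩
    - fromℤ k + fromℤ k           ≡⟨ -‿inverseˡ (fromℤ k) ⟩
    0#                            ∎)

  quadratic-integral : ∀ k l {z z′} → z + z′ ≡ fromℤ k → z * z′ ≡ fromℤ l → Integral z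
  quadratic-integral k l {z} {z′} tr nm = l ∷ ℤ.- k ∷ [] , (begin
    fromℤ l + z * (fromℤ (ℤ.- k) + z * 1#)  ≡⟨ cong₂ (λ u v → u + z * v) (sym nm)
                                                 (cong₂ _+_ (trans (cong ι ([]-neg k)) (cong -_ (sym tr)))
                                                   (*-identityʳ z)) ⟩
    z * z′ + z * (- (z + z′) + z)           ≡⟨ sym (distribˡ z z′ (- (z + z′) + z)) ⟩
    z * (z′ + (- (z + z′) + z))             ≡⟨ cong (z *_) (cancel z z′) ⟩
    z * 0#                                  ≡⟨ zeroʳ z ⟩
    0#                                      ∎)
    where
    open +-*-Solver
    cancelℚ : ∀ a b → b ℚ.+ (ℚ.- (a ℚ.+ b) ℚ.+ a) ≡ 0ℚ
    cancelℚ = solve 2 (λ a b → b :+ (:- (a :+ b) :+ a) := con 0ℚ) refl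
    cancel : ∀ x y → y + (- (x + y) + x) ≡ 0#
    cancel x y = cong₂ _+√_ (cancelℚ (re x) (re y)) (cancelℚ (im x) (im y))

  norm≢0 : (∀ r → r ℚ.* r ≢ dℚ) → ∀ x → x ≢ 0# → norm x ≢ 0ℚ
  norm≢0 nonsquare (a +√ b) x≢0 N≡0 with b ℚ.≟ 0ℚ
  ... | yes refl = x≢0 (cong (_+√ 0ℚ) (ℚ-square a (trans (sym (strip a dℚ)) N≡0)))
    where
    open +-*-Solver
    strip : ∀ a D → a ℚ.* a ℚ.- D ℚ.* (0ℚ ℚ.* 0ℚ) ≡ a ℚ.* a
    strip = solve 2 (λ a D → a :* a :- D :* (con 0ℚ :* con 0ℚ) := a :* a) refl
    ℚ-square : ∀ a → a ℚ.* a ≡ 0ℚ → a ≡ 0ℚ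
    ℚ-square a e with a ℚ.≟ 0ℚ
    ... | yes p = p
    ... | no a≢0 = trans (sym (ℚ.*-identityʳ a)) (trans (cong (a ℚ.*_) (sym (ℚ.*-inverseʳ a)))
                     (trans (sym (ℚ.*-assoc a a (ℚ.1/ a))) (trans (cong (ℚ._* ℚ.1/ a) e) (ℚ.*-zeroˡ (ℚ.1/ a)))))
      where instance _ = ℚ.≢-nonZero a≢0
  ... | no b≢0 = nonsquare (a ℚ.* c) (begin
    a ℚ.* c ℚ.* (a ℚ.* c)                        ≡⟨ expand dℚ a b c ⟩
    N ℚ.* (c ℚ.* c) ℚ.+ dℚ ℚ.* (b ℚ.* c ℚ.* (b ℚ.* c)) ≡⟨ cong₂ (λ u v → u ℚ.* (c ℚ.* c) ℚ.+ dℚ ℚ.* (v ℚ.* v)) N≡0 (ℚ.*-inverseʳ b) ⟩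
    0ℚ ℚ.* (c ℚ.* c) ℚ.+ dℚ ℚ.* (1ℚ ℚ.* 1ℚ)      ≡⟨ tidy dℚ (c ℚ.* c) ⟩
    dℚ                                           ∎)
    where
    open +-*-Solver
    instance _ = ℚ.≢-nonZero b≢0
    c N : ℚ
    c = ℚ.1/ b
    N = a ℚ.* a ℚ.- dℚ ℚ.* (b ℚ.* b)
    expand : ∀ D a b c → a ℚ.* c ℚ.* (a ℚ.* c)
             ≡ (a ℚ.* a ℚ.- D ℚ.* (b ℚ.* b)) ℚ.* (c ℚ.* c) ℚ.+ D ℚ.* (b ℚ.* c ℚ.* (b ℚ.* c))
    expand = solve 4 (λ D a b c → a :* c :* (a :* c)
      := (a :* a :- D :* (b :* b)) :* (c :* c) :+ D :* (b :* c :* (b :* c))) refl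
    tidy : ∀ D e → 0ℚ ℚ.* e ℚ.+ D ℚ.* (1ℚ ℚ.* 1ℚ) ≡ D
    tidy = solve 2 (λ D e → con 0ℚ :* e :+ D :* (con 1ℚ :* con 1ℚ) := D) refl

  module Inverse (gs : List ℚ√d) where

    G Ḡ : Pred ℚ√d 0ℓ
    G = Span (_∈ gs)
    Ḡ = Span (_∈ map conj gs)

    rs : List ℚ
    rs = map norm gs ++ cartesianProductWith pairing gs gs

    conj∈ : ∀ {g} → g ∈ gs → Ḡ (conj g)
    conj∈ p = gen (∈-map⁺ conj p)

    rs⊆ : ∀ {r} → r ∈ rs → (G · Ḡ) (ι r)
    rs⊆ r∈ with ∈-++⁻ (map norm gs) r∈
    ... | inj₁ p with ∈-map⁻ norm p
    ...   | g , g∈ , refl = subst (G · Ḡ) (x*conj-x g) (gen· (gen g∈) (conj∈ g∈))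
    rs⊆ r∈ | inj₂ p with ∈-cartesianProductWith⁻ pairing gs gs p
    ...   | g , h , g∈ , h∈ , refl = subst (G · Ḡ) (x*conj-y+y*conj-x g h)
              (add (gen· (gen g∈) (conj∈ h∈)) (gen· (gen h∈) (conj∈ g∈)))

    divisor : ∃ λ n → (G · Ḡ) (ι n) × (∀ {r} → r ∈ rs → MultipleOf n r)
    divisor = gcd-list (λ r → (G · Ḡ) (ι r)) zero add
      (λ k {r} p → subst (G · Ḡ) (sym (ι-* [ k ] r)) (scalar (fromℤ-integral k) p)) rs rs⊆

    module Divided (n c : ℚ) (n∣ : ∀ {r} → r ∈ rs → MultipleOf n r) (c*n : ι c * ι n ≡ 1#) where

      norm∣ : ∀ {g} → g ∈ gs → MultipleOf n (norm g)
      norm∣ p = n∣ (∈-++⁺ˡ (∈-map⁺ norm p))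

      pairing∣ : ∀ {g h} → g ∈ gs → h ∈ gs → MultipleOf n (pairing g h)
      pairing∣ p q = n∣ (∈-++⁺ʳ (map norm gs) (∈-cartesianProductWith⁺ pairing p q))

      divide : ∀ {r} k → r ≡ [ k ] ℚ.* n → ι c * ι r ≡ fromℤ k
      divide k refl = begin
        ι c * ι ([ k ] ℚ.* n)    ≡⟨ cong (ι c *_) (ι-* [ k ] n) ⟩
        ι c * (fromℤ k * ι n)    ≡⟨ x∙yz≈y∙xz (ι c) (fromℤ k) (ι n) ⟩
        fromℤ k * (ι c * ι n)    ≡⟨ cong (fromℤ k *_) c*n ⟩
        fromℤ k * 1#             ≡⟨ *-identityʳ (fromℤ k) ⟩
        fromℤ k                  ∎

      quotient-integral : ∀ {g h} → g ∈ gs → h ∈ gs → Integral (ι c * (g * conj h))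
      quotient-integral {g} {h} p q with norm∣ p | norm∣ q | pairing∣ p q
      ... | k , ek | l , el | m , em = quadratic-integral m (k ℤ.* l) {z′ = ι c * (h * conj g)}
        (begin
          ι c * (g * conj h) + ι c * (h * conj g)  ≡⟨ sym (distribˡ (ι c) (g * conj h) (h * conj g)) ⟩
          ι c * (g * conj h + h * conj g)          ≡⟨ cong (ι c *_) (x*conj-y+y*conj-x g h) ⟩
          ι c * ι (pairing g h)                    ≡⟨ divide m em ⟩
          fromℤ m                                  ∎)
        (begin
          ι c * (g * conj h) * (ι c * (h * conj g))        ≡⟨ *-interchange (ι c) (g * conj h) (ι c) (h * conj g) ⟩
          ι c * ι c * ((g * conj h) * (h * conj g))        ≡⟨ cong (λ u → ι c * ι c * ((g * conj h) * u)) (*-comm h (conj g)) ⟩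
          ι c * ι c * ((g * conj h) * (conj g * h))        ≡⟨ cong (ι c * ι c *_) (*-interchange g (conj h) (conj g) h) ⟩
          ι c * ι c * ((g * conj g) * (conj h * h))        ≡⟨ cong (λ u → ι c * ι c * ((g * conj g) * u)) (*-comm (conj h) h) ⟩
          ι c * ι c * ((g * conj g) * (h * conj h))        ≡⟨ *-interchange (ι c) (ι c) (g * conj g) (h * conj h) ⟩
          ι c * (g * conj g) * (ι c * (h * conj h))        ≡⟨ cong₂ (λ u v → ι c * u * (ι c * v)) (x*conj-x g) (x*conj-x h) ⟩
          ι c * ι (norm g) * (ι c * ι (norm h))            ≡⟨ cong₂ _*_ (divide k ek) (divide l el) ⟩
          fromℤ k * fromℤ l                                ≡⟨ sym (ι-* [ k ] [ l ]) ⟩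
          ι ([ k ] ℚ.* [ l ])                              ≡⟨ cong ι (sym ([]-* k l)) ⟩
          fromℤ (k ℤ.* l)                                  ∎)

      integral-product : ∀ {x y} → G x → Ḡ y → unitIdeal (ι c * (x * y))
      integral-product {x} p = Span-least (colon (colon Span-isSubmodule (ι c)) x) (on-generators p)
        where
        on-generators : ∀ {x y} → G x → y ∈ map conj gs → unitIdeal (ι c * (x * y))
        on-generators {x} {y} p y∈ with ∈-map⁻ conj y∈
        ... | h , h∈ , refl = subst (λ u → unitIdeal (ι c * u)) (*-comm (conj h) x)
          (Span-least (colon (colon Span-isSubmodule (ι c)) (conj h))
            (λ {g} g∈ → subst unitIdeal
              (trans (*-identityʳ _) (cong (ι c *_) (*-comm g (conj h))))
              (scalar (quotient-integral g∈ h∈) (gen refl)))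
            p)

      inverse-property : (G · Ḡ) (ι n) → G · (ι c ⊙ Ḡ) ≐ unitIdeal
      inverse-property n∈ = ≐-trans (·-⊙ (ι c))
        ( (λ { (y , p , refl) → Span-least (colon Span-isSubmodule (ι c))
                 (λ { (x , y , p , q , refl) → integral-product p q }) p })
        , Span-least (⊙-isSubmodule (ι c) Span-isSubmodule) (λ { refl → ι n , n∈ , sym c*n }) )

    build : (∀ r → r ℚ.* r ≢ dℚ) → ∀ {g} → g ∈ gs → g ≢ 0# →
            (∃ λ n → (G · Ḡ) (ι n) × (∀ {r} → r ∈ rs → MultipleOf n r)) →
            ∃ λ (A : FractionalIdeal) → ideal A ≡ G
    build nonsquare {g} g∈ g≢0 (n , n∈ , n∣) = record
      { ideal = G
      ; inverse = ι c ⊙ Ḡ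
      ; ideal-isSubmodule = Span-isSubmodule
      ; inverse-isSubmodule = ⊙-isSubmodule (ι c) Span-isSubmodule
      ; ideal·inverse = Divided.inverse-property n c n∣ c*n n∈ }
      , refl
      where
      n≢0 : n ≢ 0ℚ
      n≢0 n≡0 with n∣ (∈-++⁺ˡ (∈-map⁺ norm g∈))
      ... | k , e = norm≢0 nonsquare g g≢0 (trans e (trans (cong ([ k ] ℚ.*_) n≡0) (ℚ.*-zeroʳ [ k ])))

      instance _ = ℚ.≢-nonZero n≢0

      c : ℚ
      c = ℚ.1/ n

      c*n : ι c * ι n ≡ 1#
      c*n = trans (sym (ι-* c n)) (cong ι (ℚ.*-inverseˡ n))

  -- Over a quadratic field the restriction to invertible ideals loses nothing.
  nonzero-invertible : (∀ r → r ℚ.* r ≢ dℚ) → ∀ gs {g} → g ∈ gs → g ≢ 0# →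
                       ∃ λ (A : FractionalIdeal) → ideal A ≡ Span (_∈ gs)
  nonzero-invertible nonsquare gs g∈ g≢0 = Inverse.build gs nonsquare g∈ g≢0 (Inverse.divisor gs)

{-# OPTIONS --safe #-}

-- Write ω = (1 + √d) / 2 and M = p²ᵗ, so that ω² = ω + M.  For pˢ ∣ M the lattice
-- ℤpˢ + ℤω is an ideal, namely the s-th power of 𝔭 = ℤp + ℤω.  Suppose that x generates
-- it, where 1 ≤ s < t.  Then 0 < |N(x)| ≤ pˢ < pᵗ = n / 2, and, as in the descent of
-- Ankeny, Chowla and Hasse, multiplying x by n + √d or by its inverse shrinks the
-- √d-coordinate of x until x is a rational integer.  But then pˢ divides x and x
-- divides ω, which is absurd.  So the class of 𝔭 to the power qʳ⁻¹ < t is nontrivial,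
-- while its order divides qʳ by Lagrange; hence it generates the class group.
module Submission where

open import Defs
open import Algebra.Bundles using (AbelianGroup; CommutativeRing)
import Algebra.Properties.AbelianGroup as AbelianGroupProperties
import Algebra.Properties.CommutativeMonoid.Sum as Sum
import Algebra.Properties.Monoid.Mult as Mult
import Algebra.Solver.Ring.NaturalCoefficients.Default as SemiringSolver
open import Data.Empty using (⊥)
open import Data.Fin.Base as Fin using (Fin; zero; suc)
open import Data.Fin.Permutation using (Permutation′; permutation)
import Data.Fin.Properties as Fin
open import Data.Integer.Base as ℤ using (ℤ; +_; -[1+_])
open import Data.Integer.DivMod using (_%ℕ_; _/ℕ_; a≡a%ℕn+[a/ℕn]*n)
import Data.Integer.Divisibility.Signed as ℤ∣
import Data.Integer.Properties as ℤ
import Data.Integer.Tactic.RingSolver as ℤSolver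
open import Data.List.Base using (List; []; _∷_; length)
open import Data.Nat.Base as ℕ using (ℕ; zero; suc; _≤_; _<_; _∸_; NonZero; >-nonZero; s≤s; z≤n)
open import Data.Nat.Divisibility as ℕ∣ using (_∣_; divides)
open import Data.Nat.GCD using (module Bézout; module GCD)
open import Data.Nat.Induction using (<-wellFounded)
open import Data.Nat.Primality using (Prime; euclidsLemma; prime[2]; prime⇒nonZero; prime⇒nonTrivial)
import Data.Nat.Properties as ℕ
import Data.Nat.Tactic.RingSolver as ℕSolver
open import Data.Product.Base using (∃; ∃₂; _×_; _,_; proj₁; proj₂)
open import Data.Rational.Base as ℚ using (ℚ; mkℚ; 0ℚ; 1ℚ; ½; ↥_; ↧_)
import Data.Rational.Properties as ℚ
open import Data.Rational.Solver using (module +-*-Solver)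
import Data.Rational.Unnormalised.Base as ℚᵘ
import Data.Rational.Unnormalised.Properties as ℚᵘ
open import Data.Sum.Base using (_⊎_; inj₁; inj₂; [_,_]′; reduce)
open import Function.Bundles using (Bijection)
open import Function.Definitions using (Injective)
open import Induction.WellFounded using (Acc; acc)
open import Level using (0ℓ)
open import Relation.Binary.PropositionalEquality
  using (_≡_; _≢_; refl; sym; trans; cong; cong₂; subst; module ≡-Reasoning)
import Relation.Binary.Reasoning.Setoid as SetoidReasoning
open import Relation.Nullary.Decidable.Core using (yes; no)
open import Relation.Nullary.Negation using (¬_; contradiction)
open import Relation.Unary using (Pred; _≐_)
open IntegersInℚ using ([_]; []-+; []-*; []-neg; ↥*1/↧; n*1/n; ℚ-gcd; toℚᵘ-/)

-- Finite abelian groups of prime power order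

-- The threshold n / 2 comes from two identities: (2u + v)² = d v² + 4 N(x) for x = u + vω, and d ±
-- 2n = (n ± 1)². Together they trap |2u + v| between (n - 1)|v| and (n + 1)|v| as soon as 4 |N(x)|
-- < 2n. What the descent carries along is the whole property of being a generator, and the norm
-- bound is read off from it anew at every step. Much of the length goes into another obstacle:
-- integers of the field are defined as roots of monic integer polynomials, while the descent needs
-- the quotients by x to have integer coordinates in the basis 1, ω. Square-freeness of d enters
-- there.

module _ where

  open import Data.Nat.Base using (_+_; _*_; _^_)

  -- With m e = q^(k+1), the prime q divides e or m: in the first case one q is cancelled, in the
  -- second it is stripped from m and the argument recurses. All proper divisors thus divide the
  -- single number q^k, so one multiple of a group element decides whether its order is full.
  ∣-prime-power : ∀ {q} → Prime q → ∀ k {m} → m ∣ q ^ suc k → m ≡ q ^ suc k ⊎ m ∣ q ^ k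
  ∣-prime-power {q} q-prime k {m} m∣@(divides e eq)
    with euclidsLemma e m q-prime (divides (q ^ k) (trans (sym eq) (ℕ.*-comm q (q ^ k))))
  ... | inj₁ (divides e′ refl) = inj₂ (divides e′ (ℕ.*-cancelˡ-≡ (q ^ k) (e′ * m) q
          (trans eq (trans (cong (_* m) (ℕ.*-comm e′ q)) (ℕ.*-assoc q e′ m)))))
    where instance _ = prime⇒nonZero q-prime
  ... | inj₂ (divides m′ refl) = go k (ℕ∣.*-cancelˡ-∣ q (subst (_∣ q ^ suc k) (ℕ.*-comm m′ q) m∣))
    where
    instance _ = prime⇒nonZero q-prime
    go : ∀ k → m′ ∣ q ^ k → m′ * q ≡ q ^ suc k ⊎ m′ * q ∣ q ^ k
    go zero m′∣ = inj₁ (trans (cong (_* q) (ℕ∣.∣1⇒≡1 m′∣)) (ℕ.*-comm 1 q))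
    go (suc j) m′∣ with ∣-prime-power q-prime j m′∣
    ... | inj₁ refl = inj₁ (ℕ.*-comm (q ^ suc j) q)
    ... | inj₂ m′∣q^j = inj₂ (subst (_∣ q ^ suc j) (ℕ.*-comm q m′) (ℕ∣.*-monoʳ-∣ q m′∣q^j))

  -- Pigeonhole: a missed value `y` could serve as the image of one extra point, giving an injection
  -- from `Fin (suc n)` to `Fin n`.
  Fin-injective⇒surjective : ∀ {n} (f : Fin n → Fin n) → Injective _≡_ _≡_ f → ∀ y → ∃ λ x → f x ≡ y
  Fin-injective⇒surjective {n} f f-injective y with Fin.any? (λ x → f x Fin.≟ y)
  ... | yes hit = hit
  ... | no miss = contradiction (Fin.injective⇒≤ extended-injective) ℕ.1+n≰n
    where
    extended : Fin (suc n) → Fin n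
    extended zero = y
    extended (suc x) = f x

    extended-injective : Injective _≡_ _≡_ extended
    extended-injective {zero} {zero} e = refl
    extended-injective {zero} {suc x} e = contradiction (x , sym e) miss
    extended-injective {suc x} {zero} e = contradiction (x , e) miss
    extended-injective {suc x} {suc x′} e = cong suc (f-injective e)

  module FiniteAbelianGroup {a ℓ} (𝔾 : AbelianGroup a ℓ) {N : ℕ} (order : HasOrder 𝔾 N) where

    open AbelianGroup 𝔾 renaming (refl to ≈-refl; sym to ≈-sym; trans to ≈-trans)
    open AbelianGroupProperties 𝔾 using (∙-cancelʳ)
    open Sum commutativeMonoid using (sum; sum-permute; ∑-distrib-+; sum-replicate; sum-cong-≋)
    open Mult monoid using (×-homo-+; ×-assocˡ; ×-congʳ) renaming (_×_ to _·_)
    open Bijection order using (to; injective; to⁻; strictlySurjective) renaming (cong to to-cong)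
    open SetoidReasoning setoid

    to∘to⁻ : ∀ i → to (to⁻ i) ≡ i
    to∘to⁻ i = proj₂ (strictlySurjective i)

    to⁻∘to : ∀ x → to⁻ (to x) ≈ x
    to⁻∘to x = injective (to∘to⁻ (to x))

    translation : Carrier → Permutation′ N
    translation g = permutation (λ i → to (g ∙ to⁻ i)) (λ i → to (g ⁻¹ ∙ to⁻ i))
      (inverts g (g ⁻¹) (inverseʳ g)) (inverts (g ⁻¹) g (inverseˡ g))
      where
      inverts : ∀ x y → x ∙ y ≈ ε → ∀ i → to (x ∙ to⁻ (to (y ∙ to⁻ i))) ≡ i
      inverts x y xy i = trans (to-cong (begin
        x ∙ to⁻ (to (y ∙ to⁻ i))  ≈⟨ ∙-congˡ (to⁻∘to (y ∙ to⁻ i)) ⟩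
        x ∙ (y ∙ to⁻ i)           ≈⟨ ≈-sym (assoc x y (to⁻ i)) ⟩
        (x ∙ y) ∙ to⁻ i           ≈⟨ ∙-congʳ xy ⟩
        ε ∙ to⁻ i                 ≈⟨ identityˡ (to⁻ i) ⟩
        to⁻ i                     ∎)) (to∘to⁻ i)

    -- Multiplication by g permutes the factors of the product of all elements.
    order·≈ε : ∀ g → N · g ≈ ε
    order·≈ε g = ∙-cancelʳ (sum to⁻) (N · g) ε (begin
      N · g ∙ sum to⁻                               ≈⟨ ∙-congʳ (≈-sym (sum-replicate N)) ⟩
      sum {N} (λ _ → g) ∙ sum to⁻                   ≈⟨ ≈-sym (∑-distrib-+ (λ _ → g) to⁻) ⟩
      sum (λ i → g ∙ to⁻ i)                         ≈⟨ ≈-sym (sum-cong-≋ (λ i → to⁻∘to (g ∙ to⁻ i))) ⟩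
      sum (λ i → to⁻ (to (g ∙ to⁻ i)))              ≈⟨ ≈-sym (sum-permute to⁻ (translation g)) ⟩
      sum to⁻                                       ≈⟨ ≈-sym (identityˡ (sum to⁻)) ⟩
      ε ∙ sum to⁻                                   ∎)

    multiple≈ε : ∀ {g m} k → m · g ≈ ε → (k * m) · g ≈ ε
    multiple≈ε {g} {m} k m·g = begin
      (k * m) · g  ≈⟨ ≈-sym (×-assocˡ g k m) ⟩
      k · (m · g)  ≈⟨ ×-congʳ k m·g ⟩
      k · ε        ≈⟨ go k ⟩
      ε            ∎
      where
      go : ∀ k → k · ε ≈ ε
      go zero = ≈-refl
      go (suc k) = ≈-trans (identityˡ (k · ε)) (go k)

    ∣⇒·≈ε : ∀ {g m n} → m ∣ n → m · g ≈ ε → n · g ≈ ε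
    ∣⇒·≈ε (divides k refl) = multiple≈ε k

    private
      subtract : ∀ {g} d m n → d + m ≡ n → m · g ≈ ε → n · g ≈ ε → d · g ≈ ε
      subtract {g} d m n refl m·g n·g = begin
        d · g          ≈⟨ ≈-sym (identityʳ (d · g)) ⟩
        d · g ∙ ε      ≈⟨ ∙-congˡ (≈-sym m·g) ⟩
        d · g ∙ m · g  ≈⟨ ≈-sym (×-homo-+ g d m) ⟩
        (d + m) · g    ≈⟨ n·g ⟩
        ε              ∎

    -- Bézout over ℕ reads d + y n = x m (or with m and n exchanged), so the combination is formed
    -- by `subtract` and not with signed coefficients.
    gcd·≈ε : ∀ {g d m n} → GCD.GCD m n d → m · g ≈ ε → n · g ≈ ε → d · g ≈ ε
    gcd·≈ε {d = d} {m} {n} gcd m·g n·g with Bézout.identity gcd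
    ... | Bézout.+- x y e = subtract d (y * n) (x * m) e (multiple≈ε y n·g) (multiple≈ε x m·g)
    ... | Bézout.-+ x y e = subtract d (x * m) (y * n) e (multiple≈ε x m·g) (multiple≈ε y n·g)

    module Cyclic .{{_ : NonZero N}} (g : Carrier) (faithful : ∀ m → m · g ≈ ε → N ∣ m) where

      difference : ∀ m n → m · g ≈ n · g → + N ℤ∣.∣ + m ℤ.- + n
      difference m n e with ℕ.≤-total n m
      ... | inj₁ n≤m = subst (+ N ℤ∣.∣_) (sym (ℤ.m-n≡m⊖n m n)) (subst (+ N ℤ∣.∣_) (sym (ℤ.⊖-≥ n≤m))
            (ℤ∣.∣ᵤ⇒∣ (faithful (m ∸ n) (∙-cancelʳ (n · g) ((m ∸ n) · g) ε (begin
              (m ∸ n) · g ∙ n · g  ≈⟨ ≈-sym (×-homo-+ g (m ∸ n) n) ⟩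
              (m ∸ n + n) · g      ≡⟨ cong (_· g) (ℕ.m∸n+n≡m n≤m) ⟩
              m · g                ≈⟨ e ⟩
              n · g                ≈⟨ ≈-sym (identityˡ (n · g)) ⟩
              ε ∙ n · g            ∎)))))
      ... | inj₂ m≤n = subst (+ N ℤ∣.∣_) (sym (ℤ.m-n≡m⊖n m n)) (subst (+ N ℤ∣.∣_) (sym (ℤ.⊖-≤ m≤n))
            (ℤ∣.∣m⇒∣-m (ℤ∣.∣ᵤ⇒∣ (faithful (n ∸ m) (∙-cancelʳ (m · g) ((n ∸ m) · g) ε (begin
              (n ∸ m) · g ∙ m · g  ≈⟨ ≈-sym (×-homo-+ g (n ∸ m) m) ⟩
              (n ∸ m + m) · g      ≡⟨ cong (_· g) (ℕ.m∸n+n≡m m≤n) ⟩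
              n · g                ≈⟨ ≈-sym e ⟩
              m · g                ≈⟨ ≈-sym (identityˡ (m · g)) ⟩
              ε ∙ m · g            ∎))))))

      N·multiple : ∀ k → (k * N) · g ≈ ε
      N·multiple k = multiple≈ε {g} {N} k (order·≈ε g)

      congruent : ∀ m n → + N ℤ∣.∣ + m ℤ.- + n → m · g ≈ n · g
      congruent m n (ℤ∣.divides (+ k) e) = begin
        m · g                ≡⟨ cong (_· g) m≡ ⟩
        (k * N + n) · g      ≈⟨ ×-homo-+ g (k * N) n ⟩
        (k * N) · g ∙ n · g  ≈⟨ ∙-congʳ (N·multiple k) ⟩
        ε ∙ n · g            ≈⟨ identityˡ (n · g) ⟩
        n · g                ∎
        where
        add-back : ∀ i j → i ≡ (i ℤ.- j) ℤ.+ j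
        add-back = ℤSolver.solve-∀
        m≡ : m ≡ k * N + n
        m≡ = ℤ.+-injective (trans (add-back (+ m) (+ n)) (trans (cong (ℤ._+ + n) (trans e (sym (ℤ.pos-* k N))))
               (sym (ℤ.pos-+ (k * N) n))))
      congruent m n (ℤ∣.divides -[1+ k ] e) = ≈-sym (begin
        n · g                     ≡⟨ cong (_· g) n≡ ⟩
        (suc k * N + m) · g       ≈⟨ ×-homo-+ g (suc k * N) m ⟩
        (suc k * N) · g ∙ m · g   ≈⟨ ∙-congʳ (N·multiple (suc k)) ⟩
        ε ∙ m · g                 ≈⟨ identityˡ (m · g) ⟩
        m · g                     ∎)
        where
        swap : ∀ i j → j ≡ ℤ.- (i ℤ.- j) ℤ.+ i
        swap = ℤSolver.solve-∀
        neg-* : ∀ i j → ℤ.- (ℤ.- i ℤ.* j) ≡ i ℤ.* j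
        neg-* = ℤSolver.solve-∀
        n≡ : n ≡ suc k * N + m
        n≡ = ℤ.+-injective (trans (swap (+ m) (+ n)) (trans (cong (ℤ._+ + m)
               (trans (cong ℤ.-_ e) (trans (neg-* (+ suc k) (+ N)) (sym (ℤ.pos-* (suc k) N)))))
               (sym (ℤ.pos-+ (suc k * N) m))))

      power : Fin N → Fin N
      power i = to (Fin.toℕ i · g)

      power-injective : Injective _≡_ _≡_ power
      power-injective {i} {j} e = Fin.toℕ-injective (close (Fin.toℕ<n i) (Fin.toℕ<n j)
        (difference (Fin.toℕ i) (Fin.toℕ j) (injective e)))
        where
        ordered : ∀ {m n} → m < N → n ≤ m → + N ℤ∣.∣ + m ℤ.- + n → m ≡ n
        ordered {m} {n} m<N n≤m N∣ with m ∸ n in m∸n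
          | ℤ∣.∣⇒∣ᵤ (subst (+ N ℤ∣.∣_) (trans (ℤ.m-n≡m⊖n m n) (ℤ.⊖-≥ n≤m)) N∣)
        ... | zero  | _ = ℕ.≤-antisym (ℕ.m∸n≡0⇒m≤n m∸n) n≤m
        ... | suc k | N∣′ = contradiction (ℕ∣.∣⇒≤ N∣′)
                (ℕ.<⇒≱ (ℕ.≤-<-trans (ℕ.≤-trans (ℕ.≤-reflexive (sym m∸n)) (ℕ.m∸n≤m m n)) m<N))

        close : ∀ {m n} → m < N → n < N → + N ℤ∣.∣ + m ℤ.- + n → m ≡ n
        close {m} {n} m<N n<N N∣ with ℕ.≤-total n m
        ... | inj₁ n≤m = ordered m<N n≤m N∣
        ... | inj₂ m≤n = sym (ordered n<N m≤n (subst (+ N ℤ∣.∣_) (flip (+ m) (+ n)) (ℤ∣.∣m⇒∣-m N∣)))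
          where
          flip : ∀ i j → ℤ.- (i ℤ.- j) ≡ j ℤ.- i
          flip = ℤSolver.solve-∀

      -- The discrete logarithm to the base `g`, with values below N. It exists by counting: `power`
      -- is an injective self-map of `Fin N`.
      log : Carrier → ℕ
      log x = Fin.toℕ (proj₁ (Fin-injective⇒surjective power power-injective (to x)))

      log-correct : ∀ x → log x · g ≈ x
      log-correct x = injective (proj₂ (Fin-injective⇒surjective power power-injective (to x)))

      -- Reduces each homomorphism law to exhibiting some exponent for the element in question.
      log-unique : ∀ {x} m → x ≈ m · g → + N ℤ∣.∣ + log x ℤ.- + m
      log-unique {x} m e = difference (log x) m (≈-trans (log-correct x) e)

      isomorphism : 𝔾 ≅ ℤ/ N ℤ
      isomorphism = (λ x → + log x) , record
        { isGroupMonomorphism = record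
          { isGroupHomomorphism = record
            { isMonoidHomomorphism = record
              { isMagmaHomomorphism = record
                { isRelHomomorphism = record
                  { cong = λ {x} {y} x≈y → log-unique (log y) (≈-trans x≈y (≈-sym (log-correct y))) }
                ; homo = λ x y → log-unique {x ∙ y} (log x + log y) (begin
                    x ∙ y                    ≈⟨ ≈-sym (∙-cong (log-correct x) (log-correct y)) ⟩
                    log x · g ∙ log y · g    ≈⟨ ≈-sym (×-homo-+ g (log x) (log y)) ⟩
                    (log x + log y) · g      ∎) }
              ; ε-homo = log-unique 0 ≈-refl }
            ; ⁻¹-homo = λ x → subst (+ N ℤ∣.∣_) (negate (+ log (x ⁻¹)) (+ log x))
                (difference (log (x ⁻¹) + log x) 0 (begin
                  (log (x ⁻¹) + log x) · g       ≈⟨ ×-homo-+ g (log (x ⁻¹)) (log x) ⟩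
                  log (x ⁻¹) · g ∙ log x · g     ≈⟨ ∙-cong (log-correct (x ⁻¹)) (log-correct x) ⟩
                  x ⁻¹ ∙ x                       ≈⟨ inverseˡ x ⟩
                  ε                              ∎)) }
          ; injective = λ {x} {y} N∣ → begin
              x            ≈⟨ ≈-sym (log-correct x) ⟩
              log x · g    ≈⟨ congruent (log x) (log y) N∣ ⟩
              log y · g    ≈⟨ log-correct y ⟩
              y            ∎ }
        -- Multiples of `g` have natural coefficients, so the integer `i` is first replaced by its
        -- residue modulo N.
        ; surjective = λ i → residue i · g , λ {z} z≈ →
            subst (+ N ℤ∣.∣_) (telescope (+ log z) (+ residue i) i)
              (ℤ∣.∣m∣n⇒∣m+n (log-unique (residue i) z≈) (residue-correct i)) }
        where
        negate : ∀ i j → (i ℤ.+ j) ℤ.- ℤ.0ℤ ≡ i ℤ.- ℤ.- j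
        negate = ℤSolver.solve-∀

        telescope : ∀ i j k → (i ℤ.- j) ℤ.+ (j ℤ.- k) ≡ i ℤ.- k
        telescope = ℤSolver.solve-∀

        residue : ℤ → ℕ
        residue i = i %ℕ N

        residue-correct : ∀ i → + N ℤ∣.∣ + residue i ℤ.- i
        residue-correct i = ℤ∣.divides (ℤ.- (i /ℕ N)) (trans (cong (λ j → + residue i ℤ.- j) (a≡a%ℕn+[a/ℕn]*n i N))
          (cancel (+ residue i) (i /ℕ N) (+ N)))
          where
          cancel : ∀ r k n → r ℤ.- (r ℤ.+ k ℤ.* n) ≡ ℤ.- k ℤ.* n
          cancel = ℤSolver.solve-∀

  module _ {a ℓ} (𝔾 : AbelianGroup a ℓ) where

    open AbelianGroup 𝔾 using (_≈_; ε; monoid)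
    open Mult monoid using () renaming (_×_ to _·_)

    prime-power-order⇒cyclic : ∀ {q} → Prime q → ∀ k → HasOrder 𝔾 (q ^ suc k) →
                               ∀ g → ¬ (q ^ k) · g ≈ ε → 𝔾 ≅ ℤ/ (q ^ suc k) ℤ
    prime-power-order⇒cyclic {q} q-prime k order g q^k·g≉ε = Cyclic.isomorphism g faithful
      where
      open FiniteAbelianGroup 𝔾 order
      instance
        _ = prime⇒nonZero q-prime
        _ = ℕ.m^n≢0 q (suc k)

      faithful : ∀ m → m · g ≈ ε → q ^ suc k ∣ m
      -- The gcd of m and q^(k+1) also annihilates `g`. It is either q^(k+1) itself or a divisor of
      -- q^k, and `q^k·g≉ε` excludes the latter.
      faithful m m·g≈ε with Bézout.lemma m (q ^ suc k)
      ... | Bézout.result d gcd _ with ∣-prime-power q-prime k (GCD.gcd∣n gcd)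
      ... | inj₁ refl = GCD.gcd∣m gcd
      ... | inj₂ d∣q^k = contradiction
              (∣⇒·≈ε d∣q^k (gcd·≈ε gcd m·g≈ε (order·≈ε g))) q^k·g≉ε

-- The norm form u² + uv - Mv² and its units

module _ where

  open import Data.Nat.Base using (_+_; _*_; _^_)

  -- As b ≥ 1, the slack 2n is at most 2n b², which completes the squares to (n + 1)² b² above and
  -- (n - 1)² b² below. The lower bound has the form n b < a + b to avoid truncated subtraction.
  square-near : ∀ n a b → 1 ≤ b →
                a * a < (n * n + 1) * (b * b) + 2 * n →
                (n * n + 1) * (b * b) < a * a + 2 * n →
                a < n * b + b × n * b < a + b
  square-near n a b 1≤b a²<  <a² = ℕ.≰⇒> too-large , ℕ.≰⇒> (too-small n <a²)
    where
    open ℕ.≤-Reasoning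

    2n≤2nb² : ∀ n → 2 * n ≤ 2 * n * (b * b)
    2n≤2nb² n = ℕ.m≤m*n (2 * n) (b * b) {{>-nonZero (ℕ.*-mono-≤ 1≤b 1≤b)}}

    too-large : ¬ n * b + b ≤ a
    too-large le = ℕ.<⇒≱ a²< (begin
      (n * n + 1) * (b * b) + 2 * n                  ≤⟨ ℕ.+-monoʳ-≤ ((n * n + 1) * (b * b)) (2n≤2nb² n) ⟩
      (n * n + 1) * (b * b) + 2 * n * (b * b)        ≡⟨ eq n b ⟩
      (n * b + b) * (n * b + b)                      ≤⟨ ℕ.*-mono-≤ le le ⟩
      a * a                                          ∎)
      where
      eq : ∀ n b → (n * n + 1) * (b * b) + 2 * n * (b * b) ≡ (n * b + b) * (n * b + b)
      eq = ℕSolver.solve-∀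

    too-small : ∀ n → (n * n + 1) * (b * b) < a * a + 2 * n → ¬ a + b ≤ n * b
    too-small zero _ le = ℕ.<⇒≱ (ℕ.<-≤-trans 1≤b (ℕ.m≤n+m b a)) le
    -- From here `suc n` stands for the n of the lemma, so that n - 1 is available as `n`.
    too-small (suc n) <a² le = ℕ.<⇒≱ <a² (begin
      a * a + 2 * suc n                              ≤⟨ ℕ.+-mono-≤ (ℕ.*-mono-≤ a≤nb a≤nb) (2n≤2nb² (suc n)) ⟩
      n * b * (n * b) + 2 * suc n * (b * b)          ≡⟨ eq n b ⟩
      (suc n * suc n + 1) * (b * b)                  ∎)
      where
      a≤nb : a ≤ n * b
      a≤nb = ℕ.+-cancelʳ-≤ b a (n * b) (ℕ.≤-trans le (ℕ.≤-reflexive (ℕ.+-comm b (n * b))))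
      eq : ∀ n b → n * b * (n * b) + 2 * suc n * (b * b) ≡ (suc n * suc n + 1) * (b * b)
      eq = ℕSolver.solve-∀

  ∣⊖∣-< : ∀ {m n k} → m < n + k → n < m + k → ℤ.∣ m ℤ.⊖ n ∣ < k
  ∣⊖∣-< {m} {n} {k} m< n< with ℕ.≤-total m n
  ... | inj₁ m≤n = subst (_< k) (sym (ℤ.∣⊖∣-≤ m≤n))
          (ℕ.+-cancelˡ-< m (n ∸ m) k (subst (_< m + k) (sym (ℕ.m+[n∸m]≡n m≤n)) n<))
  ... | inj₂ n≤m = subst (_< k) (sym (trans (ℤ.∣m⊖n∣≡∣n⊖m∣ m n) (ℤ.∣⊖∣-≤ n≤m)))
          (ℕ.+-cancelˡ-< n (m ∸ n) k (subst (_< n + k) (sym (ℕ.m+[n∸m]≡n n≤m)) m<))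

  i≡±∣i∣ : ∀ i → i ≡ + ℤ.∣ i ∣ ⊎ i ≡ ℤ.- + ℤ.∣ i ∣
  i≡±∣i∣ (+ n) = inj₁ refl
  i≡±∣i∣ -[1+ n ] = inj₂ refl

  i*i≡+∣i∣*∣i∣ : ∀ i → i ℤ.* i ≡ + (ℤ.∣ i ∣ * ℤ.∣ i ∣)
  i*i≡+∣i∣*∣i∣ (+ n) = sym (ℤ.pos-* n n)
  i*i≡+∣i∣*∣i∣ -[1+ n ] = refl

  -- Equal signs of `i` and `j` call for the difference, opposite signs for the sum; either way the
  -- result is |i| - n|j| up to sign.
  ∣i±n*j∣<∣j∣ : ∀ n i j → ℤ.∣ i ∣ < n * ℤ.∣ j ∣ + ℤ.∣ j ∣ → n * ℤ.∣ j ∣ < ℤ.∣ i ∣ + ℤ.∣ j ∣ →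
                ℤ.∣ i ℤ.+ + n ℤ.* j ∣ < ℤ.∣ j ∣ ⊎ ℤ.∣ i ℤ.- + n ℤ.* j ∣ < ℤ.∣ j ∣
  ∣i±n*j∣<∣j∣ n i j upper lower with i≡±∣i∣ i | i≡±∣i∣ j
  ... | inj₁ p | inj₁ q = inj₂ (subst (_< ℤ.∣ j ∣) (cong ℤ.∣_∣ (sym
          (trans (cong₂ (λ x y → x ℤ.- + n ℤ.* y) p q) (trans (cong (λ y → + ℤ.∣ i ∣ ℤ.- y) (sym (ℤ.pos-* n ℤ.∣ j ∣)))
            (ℤ.m-n≡m⊖n ℤ.∣ i ∣ (n * ℤ.∣ j ∣)))))) (∣⊖∣-< upper lower))
  ... | inj₁ p | inj₂ q = inj₁ (subst (_< ℤ.∣ j ∣) (cong ℤ.∣_∣ (sym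
          (trans (cong₂ (λ x y → x ℤ.+ + n ℤ.* y) p q) (trans (eq (+ ℤ.∣ i ∣) (+ n) (+ ℤ.∣ j ∣))
            (trans (cong (λ y → + ℤ.∣ i ∣ ℤ.- y) (sym (ℤ.pos-* n ℤ.∣ j ∣)))
            (ℤ.m-n≡m⊖n ℤ.∣ i ∣ (n * ℤ.∣ j ∣))))))) (∣⊖∣-< upper lower))
    where
    eq : ∀ i n j → i ℤ.+ n ℤ.* ℤ.- j ≡ i ℤ.- n ℤ.* j
    eq = ℤSolver.solve-∀
  ... | inj₂ p | inj₁ q = inj₁ (subst (_< ℤ.∣ j ∣) (cong ℤ.∣_∣ (sym
          (trans (cong₂ (λ x y → x ℤ.+ + n ℤ.* y) p q) (trans (eq (+ ℤ.∣ i ∣) (+ n) (+ ℤ.∣ j ∣))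
            (trans (cong (λ y → y ℤ.- + ℤ.∣ i ∣) (sym (ℤ.pos-* n ℤ.∣ j ∣)))
            (ℤ.m-n≡m⊖n (n * ℤ.∣ j ∣) ℤ.∣ i ∣)))))) (∣⊖∣-< lower upper))
    where
    eq : ∀ i n j → ℤ.- i ℤ.+ n ℤ.* j ≡ n ℤ.* j ℤ.- i
    eq = ℤSolver.solve-∀
  ... | inj₂ p | inj₂ q = inj₂ (subst (_< ℤ.∣ j ∣) (cong ℤ.∣_∣ (sym
          (trans (cong₂ (λ x y → x ℤ.- + n ℤ.* y) p q) (trans (eq (+ ℤ.∣ i ∣) (+ n) (+ ℤ.∣ j ∣))
            (trans (cong (λ y → y ℤ.- + ℤ.∣ i ∣) (sym (ℤ.pos-* n ℤ.∣ j ∣)))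
            (ℤ.m-n≡m⊖n (n * ℤ.∣ j ∣) ℤ.∣ i ∣)))))) (∣⊖∣-< lower upper))
    where
    eq : ∀ i n j → ℤ.- i ℤ.- n ℤ.* ℤ.- j ≡ n ℤ.* j ℤ.- i
    eq = ℤSolver.solve-∀

  -- With ω² = ω + M, the element u + vω lies in the lattice ℤm + ℤω and divides
  -- both m and ω, with quotients a + bω and e + fω.
  record Generates (M : ℤ) (m : ℕ) (u v : ℤ) : Set where
    field
      k a b e f : ℤ
      u≡km : u ≡ k ℤ.* + m
      re-m : u ℤ.* a ℤ.+ M ℤ.* (v ℤ.* b) ≡ + m
      im-m : u ℤ.* b ℤ.+ v ℤ.* a ℤ.+ v ℤ.* b ≡ ℤ.0ℤ
      re-ω : u ℤ.* e ℤ.+ M ℤ.* (v ℤ.* f) ≡ ℤ.0ℤ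
      im-ω : u ℤ.* f ℤ.+ v ℤ.* e ℤ.+ v ℤ.* f ≡ ℤ.1ℤ

  -- Multiplication by the unit 2q - 1 + 2ω, whose inverse is - (2q + 1) + 2ω.
  Generates-unit : ∀ q {M} c {m u v} → q ℤ.* q ≡ M → M ≡ c ℤ.* + m → Generates M m u v →
    Generates M m (u ℤ.* ((+ 2) ℤ.* q ℤ.- ℤ.1ℤ) ℤ.+ M ℤ.* (v ℤ.* (+ 2))) ((+ 2) ℤ.* u ℤ.+ v ℤ.+ (+ 2) ℤ.* q ℤ.* v)
  Generates-unit q c {m} {u} {v} refl q²≡cm g = record
    { k = k ℤ.* ((+ 2) ℤ.* q ℤ.- ℤ.1ℤ) ℤ.+ c ℤ.* (v ℤ.* (+ 2))
    ; a = q ℤ.* q ℤ.* (b ℤ.* (+ 2)) ℤ.- a ℤ.* ((+ 2) ℤ.* q ℤ.+ ℤ.1ℤ)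
    ; b = (+ 2) ℤ.* a ℤ.+ b ℤ.- (+ 2) ℤ.* q ℤ.* b
    ; e = q ℤ.* q ℤ.* (f ℤ.* (+ 2)) ℤ.- e ℤ.* ((+ 2) ℤ.* q ℤ.+ ℤ.1ℤ)
    ; f = (+ 2) ℤ.* e ℤ.+ f ℤ.- (+ 2) ℤ.* q ℤ.* f
    ; u≡km = trans (cong₂ (λ x y → x ℤ.* ((+ 2) ℤ.* q ℤ.- ℤ.1ℤ) ℤ.+ y ℤ.* (v ℤ.* (+ 2))) u≡km q²≡cm)
               (factor q v k c (+ m))
    ; re-m = trans (re≡ q u v a b) re-m
    ; im-m = trans (im≡ q u v a b) im-m
    ; re-ω = trans (re≡ q u v e f) re-ω
    ; im-ω = trans (im≡ q u v e f) im-ω }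
    where
    open Generates g
    factor : ∀ q v k c m → k ℤ.* m ℤ.* ((+ 2) ℤ.* q ℤ.- ℤ.1ℤ) ℤ.+ c ℤ.* m ℤ.* (v ℤ.* (+ 2))
      ≡ (k ℤ.* ((+ 2) ℤ.* q ℤ.- ℤ.1ℤ) ℤ.+ c ℤ.* (v ℤ.* (+ 2))) ℤ.* m
    factor = ℤSolver.solve-∀
    re≡ : ∀ q u v a b →
      (u ℤ.* ((+ 2) ℤ.* q ℤ.- ℤ.1ℤ) ℤ.+ q ℤ.* q ℤ.* (v ℤ.* (+ 2)))
        ℤ.* (q ℤ.* q ℤ.* (b ℤ.* (+ 2)) ℤ.- a ℤ.* ((+ 2) ℤ.* q ℤ.+ ℤ.1ℤ))
        ℤ.+ q ℤ.* q ℤ.* (((+ 2) ℤ.* u ℤ.+ v ℤ.+ (+ 2) ℤ.* q ℤ.* v) ℤ.* ((+ 2) ℤ.* a ℤ.+ b ℤ.- (+ 2) ℤ.* q ℤ.* b))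
      ≡ u ℤ.* a ℤ.+ q ℤ.* q ℤ.* (v ℤ.* b)
    re≡ = ℤSolver.solve-∀
    im≡ : ∀ q u v a b →
      (u ℤ.* ((+ 2) ℤ.* q ℤ.- ℤ.1ℤ) ℤ.+ q ℤ.* q ℤ.* (v ℤ.* (+ 2))) ℤ.* ((+ 2) ℤ.* a ℤ.+ b ℤ.- (+ 2) ℤ.* q ℤ.* b)
        ℤ.+ ((+ 2) ℤ.* u ℤ.+ v ℤ.+ (+ 2) ℤ.* q ℤ.* v) ℤ.* (q ℤ.* q ℤ.* (b ℤ.* (+ 2)) ℤ.- a ℤ.* ((+ 2) ℤ.* q ℤ.+ ℤ.1ℤ))
        ℤ.+ ((+ 2) ℤ.* u ℤ.+ v ℤ.+ (+ 2) ℤ.* q ℤ.* v) ℤ.* ((+ 2) ℤ.* a ℤ.+ b ℤ.- (+ 2) ℤ.* q ℤ.* b)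
      ≡ u ℤ.* b ℤ.+ v ℤ.* a ℤ.+ v ℤ.* b
    im≡ = ℤSolver.solve-∀

  private
    transport : ∀ {i j k} → i ≡ j → ℤ.∣ i ∣ < k → ℤ.∣ j ∣ < k
    transport refl lt = lt

    square-neg : ∀ q → ℤ.- q ℤ.* ℤ.- q ≡ q ℤ.* q
    square-neg = ℤSolver.solve-∀

    plus : ∀ Q w v → w ℤ.+ + (2 * Q) ℤ.* v ≡ w ℤ.+ (+ 2) ℤ.* + Q ℤ.* v
    plus Q w v = cong (λ x → w ℤ.+ x ℤ.* v) (ℤ.pos-* 2 Q)

    minus : ∀ Q w v → w ℤ.- + (2 * Q) ℤ.* v ≡ w ℤ.+ (+ 2) ℤ.* ℤ.- + Q ℤ.* v
    minus Q w v = trans (cong (λ x → w ℤ.- x ℤ.* v) (ℤ.pos-* 2 Q)) (eq w (+ Q) v)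
      where
      eq : ∀ w q v → w ℤ.- (+ 2) ℤ.* q ℤ.* v ≡ w ℤ.+ (+ 2) ℤ.* ℤ.- q ℤ.* v
      eq = ℤSolver.solve-∀

  -- The descent on the ω-coordinate of a generator

  module Descent (Q : ℕ) where

    n : ℕ
    n = 2 * Q

    M : ℤ
    M = + Q ℤ.* + Q

    normForm : ℤ → ℤ → ℤ
    normForm u v = u ℤ.* u ℤ.+ u ℤ.* v ℤ.- M ℤ.* (v ℤ.* v)

    module _ {m : ℕ} (1≤m : 1 ≤ m) (m<Q : m < Q) where

      -- The determinant of multiplication by u + vω is its norm.
      norm-bound : ∀ {u v} → Generates M m u v → ℤ.∣ normForm u v ∣ < Q
      norm-bound {u} {v} g = ℕ.≤-<-trans (ℕ∣.∣⇒≤ {{>-nonZero 1≤m}} (divides ℤ.∣ a ℤ.* f ℤ.- b ℤ.* e ∣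
        (trans (cong ℤ.∣_∣ m≡) (trans (ℤ.abs-* (normForm u v) (a ℤ.* f ℤ.- b ℤ.* e))
          (ℕ.*-comm ℤ.∣ normForm u v ∣ ℤ.∣ a ℤ.* f ℤ.- b ℤ.* e ∣))))) m<Q
        where
        open Generates g
        det : ∀ M u v a b e f →
          (u ℤ.* a ℤ.+ M ℤ.* (v ℤ.* b)) ℤ.* (u ℤ.* f ℤ.+ v ℤ.* e ℤ.+ v ℤ.* f)
            ℤ.- (u ℤ.* b ℤ.+ v ℤ.* a ℤ.+ v ℤ.* b) ℤ.* (u ℤ.* e ℤ.+ M ℤ.* (v ℤ.* f))
          ≡ (u ℤ.* u ℤ.+ u ℤ.* v ℤ.- M ℤ.* (v ℤ.* v)) ℤ.* (a ℤ.* f ℤ.- b ℤ.* e)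
        det = ℤSolver.solve-∀
        simplify : ∀ m → m ≡ m ℤ.* ℤ.1ℤ ℤ.- ℤ.0ℤ ℤ.* ℤ.0ℤ
        simplify = ℤSolver.solve-∀
        m≡ : + m ≡ normForm u v ℤ.* (a ℤ.* f ℤ.- b ℤ.* e)
        m≡ = trans (trans (simplify (+ m))
               (sym (cong₂ ℤ._-_ (cong₂ ℤ._*_ re-m im-ω) (cong₂ ℤ._*_ im-m re-ω))))
               (det M u v a b e f)

      -- Twice u + vω is (2u + v) + v√d, whose norm is 4N. By `norm-bound`, 4|N| < 4Q = 2n, which is
      -- exactly the slack that `square-near` allows.
      near : ∀ {u v} → Generates M m u v → 1 ≤ ℤ.∣ v ∣ →
             ℤ.∣ (+ 2) ℤ.* u ℤ.+ v ∣ < n * ℤ.∣ v ∣ + ℤ.∣ v ∣ × n * ℤ.∣ v ∣ < ℤ.∣ (+ 2) ℤ.* u ℤ.+ v ∣ + ℤ.∣ v ∣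
      near {u} {v} g 1≤v = square-near n A B 1≤v (proj₁ D-bounds) (proj₂ D-bounds)
        where
        i : ℤ
        i = (+ 2) ℤ.* u ℤ.+ v
        A B D : ℕ
        A = ℤ.∣ i ∣
        B = ℤ.∣ v ∣
        D = (n * n + 1) * (B * B)

        complete-square : ∀ Q u v → ((+ 2) ℤ.* u ℤ.+ v) ℤ.* ((+ 2) ℤ.* u ℤ.+ v)
          ≡ (+ 4) ℤ.* (u ℤ.* u ℤ.+ u ℤ.* v ℤ.- Q ℤ.* Q ℤ.* (v ℤ.* v))
            ℤ.+ (((+ 2) ℤ.* Q) ℤ.* ((+ 2) ℤ.* Q) ℤ.+ (+ 1)) ℤ.* (v ℤ.* v)
        complete-square = ℤSolver.solve-∀

        +D≡ : (((+ 2) ℤ.* + Q) ℤ.* ((+ 2) ℤ.* + Q) ℤ.+ (+ 1)) ℤ.* (v ℤ.* v) ≡ + D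
        +D≡ = trans (cong₂ (λ x y → (x ℤ.* x ℤ.+ (+ 1)) ℤ.* y) (sym (ℤ.pos-* 2 Q)) (i*i≡+∣i∣*∣i∣ v))
          (trans (cong (λ x → (x ℤ.+ (+ 1)) ℤ.* + (B * B)) (sym (ℤ.pos-* n n)))
            (trans (cong (ℤ._* + (B * B)) (sym (ℤ.pos-+ (n * n) 1))) (sym (ℤ.pos-* (n * n + 1) (B * B)))))

        A²≡ : + (A * A) ≡ (+ 4) ℤ.* normForm u v ℤ.+ + D
        A²≡ = trans (sym (i*i≡+∣i∣*∣i∣ i)) (trans (complete-square (+ Q) u v)
                (cong (λ x → (+ 4) ℤ.* normForm u v ℤ.+ x) +D≡))

        4N<2n : 4 * ℤ.∣ normForm u v ∣ < 2 * n
        4N<2n = subst (4 * ℤ.∣ normForm u v ∣ <_) (ℕ.*-assoc 2 2 Q) (ℕ.*-monoʳ-< 4 (norm-bound g))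

        -- The sign of N decides which inequality uses the bound on 4|N|; the other one only needs
        -- 2n > 0.
        bounds : ∀ N → + (A * A) ≡ (+ 4) ℤ.* N ℤ.+ + D → 4 * ℤ.∣ N ∣ < 2 * n →
                 A * A < D + 2 * n × D < A * A + 2 * n
        bounds N eq N< with i≡±∣i∣ N
        ... | inj₁ p = subst (_< D + 2 * n) (sym A²≡′) (ℕ.+-monoʳ-< D N<)
                     , ℕ.<-≤-trans (ℕ.m<m+n D (ℕ.≤-<-trans z≤n N<))
                         (ℕ.+-monoˡ-≤ (2 * n) (subst (D ≤_) (sym A²≡′) (ℕ.m≤m+n D (4 * ℤ.∣ N ∣))))
          where
          A²≡′ : A * A ≡ D + 4 * ℤ.∣ N ∣
          A²≡′ = ℤ.+-injective (trans eq (trans (cong (λ x → (+ 4) ℤ.* x ℤ.+ + D) p)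
            (trans (cong (ℤ._+ + D) (sym (ℤ.pos-* 4 ℤ.∣ N ∣))) (trans (ℤ.+-comm (+ (4 * ℤ.∣ N ∣)) (+ D))
              (sym (ℤ.pos-+ D (4 * ℤ.∣ N ∣)))))))
        ... | inj₂ p = ℕ.<-≤-trans (ℕ.m<m+n (A * A) (ℕ.≤-<-trans z≤n N<))
                         (ℕ.+-monoˡ-≤ (2 * n) (subst (A * A ≤_) (sym D≡′) (ℕ.m≤m+n (A * A) (4 * ℤ.∣ N ∣))))
                     , subst (_< A * A + 2 * n) (sym D≡′) (ℕ.+-monoʳ-< (A * A) N<)
          where
          move : ∀ N D → D ≡ ((+ 4) ℤ.* ℤ.- N ℤ.+ D) ℤ.+ (+ 4) ℤ.* N
          move = ℤSolver.solve-∀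
          D≡′ : D ≡ A * A + 4 * ℤ.∣ N ∣
          D≡′ = ℤ.+-injective (trans (move (+ ℤ.∣ N ∣) (+ D))
            (trans (cong₂ ℤ._+_ (sym (trans eq (cong (λ x → (+ 4) ℤ.* x ℤ.+ + D) p))) (sym (ℤ.pos-* 4 ℤ.∣ N ∣)))
              (sym (ℤ.pos-+ (A * A) (4 * ℤ.∣ N ∣)))))

        D-bounds : A * A < D + 2 * n × D < A * A + 2 * n
        D-bounds = bounds (normForm u v) A²≡ 4N<2n

      -- By `near`, |2u + v| is within |v| of n|v|, so adding n v with the sign that opposes 2u + v
      -- leaves less than |v|. Hiding the sign in `q` lets 2q + √d stand both for n + √d and for its
      -- inverse √d - n.
      descend : ∀ {u v} → Generates M m u v → 1 ≤ ℤ.∣ v ∣ →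
                ∃ λ q → q ℤ.* q ≡ M × ℤ.∣ (+ 2) ℤ.* u ℤ.+ v ℤ.+ (+ 2) ℤ.* q ℤ.* v ∣ < ℤ.∣ v ∣
      descend {u} {v} g 1≤v = choose (∣i±n*j∣<∣j∣ n ((+ 2) ℤ.* u ℤ.+ v) v (proj₁ (near g 1≤v)) (proj₂ (near g 1≤v)))
        where
        choose : ℤ.∣ (+ 2) ℤ.* u ℤ.+ v ℤ.+ + n ℤ.* v ∣ < ℤ.∣ v ∣ ⊎ ℤ.∣ (+ 2) ℤ.* u ℤ.+ v ℤ.- + n ℤ.* v ∣ < ℤ.∣ v ∣ →
                 ∃ λ q → q ℤ.* q ≡ M × ℤ.∣ (+ 2) ℤ.* u ℤ.+ v ℤ.+ (+ 2) ℤ.* q ℤ.* v ∣ < ℤ.∣ v ∣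
        choose (inj₁ lt) = + Q , refl , transport (plus Q ((+ 2) ℤ.* u ℤ.+ v) v) lt
        choose (inj₂ lt) = ℤ.- + Q , square-neg (+ Q) , transport (minus Q ((+ 2) ℤ.* u ℤ.+ v) v) lt

      not-generated : 2 ≤ m → ∀ c → M ≡ c ℤ.* + m → ∀ {u v} → ¬ Generates M m u v
      not-generated 2≤m c M≡cm {u} {v} g = go u v g (<-wellFounded ℤ.∣ v ∣)
        where
        -- For v = 0 the equation `im-ω` becomes u f = 1, while m divides u.
        rational : ∀ u → ¬ Generates M m u ℤ.0ℤ
        rational u g = ℕ.<⇒≱ 2≤m (ℕ.≤-reflexive (ℕ∣.∣1⇒≡1 (divides ℤ.∣ k ℤ.* f ∣
          (trans (cong ℤ.∣_∣ 1≡) (ℤ.abs-* (k ℤ.* f) (+ m))))))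
          where
          open Generates g
          drop : ∀ k m e f → k ℤ.* m ℤ.* f ℤ.+ ℤ.0ℤ ℤ.* e ℤ.+ ℤ.0ℤ ℤ.* f ≡ k ℤ.* f ℤ.* m
          drop = ℤSolver.solve-∀
          1≡ : ℤ.1ℤ ≡ k ℤ.* f ℤ.* + m
          1≡ = trans (sym im-ω) (trans (cong (λ u → u ℤ.* f ℤ.+ ℤ.0ℤ ℤ.* e ℤ.+ ℤ.0ℤ ℤ.* f) u≡km) (drop k (+ m) e f))

        go : ∀ u v → Generates M m u v → Acc _<_ ℤ.∣ v ∣ → ⊥
        step : ∀ u v → Generates M m u v → 1 ≤ ℤ.∣ v ∣ → Acc _<_ ℤ.∣ v ∣ → ⊥
        go u (+ 0) g _ = rational u g
        go u v@(+ suc _) g rec = step u v g (s≤s z≤n) rec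
        go u v@(-[1+ _ ]) g rec = step u v g (s≤s z≤n) rec
        step u v g 1≤v (acc smaller) = let q , q²≡M , lt = descend g 1≤v in
          go _ _ (Generates-unit q c q²≡M M≡cm g) (smaller lt)

-- Integral elements of quadratic fields

open ≡-Reasoning

[]-injective : ∀ {i j} → [ i ] ≡ [ j ] → i ≡ j
[]-injective {i} {j} e with ℚᵘ.≃-trans (ℚᵘ.≃-sym (toℚᵘ-/ i 0))
  (ℚᵘ.≃-trans (ℚᵘ.≃-reflexive (cong ℚ.toℚᵘ e)) (toℚᵘ-/ j 0))
... | ℚᵘ.*≡* eq = trans (sym (ℤ.*-identityʳ i)) (trans eq (ℤ.*-identityʳ j))

IsInteger : Pred ℚ 0ℓ
IsInteger r = ∃ λ k → r ≡ [ k ]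

integer-+ : ∀ {r s} → IsInteger r → IsInteger s → IsInteger (r ℚ.+ s)
integer-+ (i , refl) (j , refl) = i ℤ.+ j , sym ([]-+ i j)

integer-* : ∀ {r s} → IsInteger r → IsInteger s → IsInteger (r ℚ.* s)
integer-* (i , refl) (j , refl) = i ℤ.* j , sym ([]-* i j)

integer-neg : ∀ {r} → IsInteger r → IsInteger (ℚ.- r)
integer-neg (i , refl) = ℤ.- i , sym ([]-neg i)

∣i∣≡1⇒i*i≡1 : ∀ i → ℤ.∣ i ∣ ≡ 1 → i ℤ.* i ≡ ℤ.1ℤ
∣i∣≡1⇒i*i≡1 (+ 1) refl = refl
∣i∣≡1⇒i*i≡1 -[1+ 0 ] refl = refl

-- Both denominator arguments below write a rational number as b / a in lowest terms and finish here
-- once a = ±1; `g` is then 1 / a, which equals a.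
unit-denominator : ∀ a b {g} → ℤ.∣ a ∣ ≡ 1 → 1ℚ ≡ [ a ] ℚ.* g → IsInteger ([ b ] ℚ.* g)
unit-denominator a b {g} ∣a∣≡1 1≡ag = b ℤ.* a , trans (cong ([ b ] ℚ.*_) g≡a) (sym ([]-* b a))
  where
  g≡a : g ≡ [ a ]
  g≡a = begin
    g                          ≡⟨ sym (ℚ.*-identityˡ g) ⟩
    1ℚ ℚ.* g                   ≡⟨ cong (λ k → [ k ] ℚ.* g) (sym (∣i∣≡1⇒i*i≡1 a ∣a∣≡1)) ⟩
    [ a ℤ.* a ] ℚ.* g          ≡⟨ cong (ℚ._* g) ([]-* a a) ⟩
    [ a ] ℚ.* [ a ] ℚ.* g      ≡⟨ ℚ.*-assoc [ a ] [ a ] g ⟩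
    [ a ] ℚ.* ([ a ] ℚ.* g)    ≡⟨ cong ([ a ] ℚ.*_) (sym 1≡ag) ⟩
    [ a ] ℚ.* 1ℚ               ≡⟨ ℚ.*-identityʳ [ a ] ⟩
    [ a ]                      ∎

infixr 8 _^ℚ_

_^ℚ_ : ℚ → ℕ → ℚ
r ^ℚ zero = 1ℚ
r ^ℚ suc j = r ℚ.* r ^ℚ j

-- Dividing E by the denominator of r preserves the hypothesis.
bounded-denominators⇒integer : ∀ E r → E ≢ ℤ.0ℤ → (∀ j → IsInteger ([ E ] ℚ.* r ^ℚ j)) → IsInteger r
bounded-denominators⇒integer E r E≢0 integral with ℚ-gcd 1ℚ r
-- `g` generates ℤ + ℤr, so `a` is the denominator of r up to sign and E g = E / a. This is again an
-- integer that clears all powers of r, because g = u + v r combines consecutive powers.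
... | g , (a , 1≡ag) , (b , refl) , u , v , g≡ = go E E≢0 integral (<-wellFounded ℤ.∣ E ∣)
  where
  open +-*-Solver

  distribute : ∀ E g y → E ℚ.* g ℚ.* y ≡ g ℚ.* (E ℚ.* y)
  distribute = solve 3 (λ E g y → E :* g :* y := g :* (E :* y)) refl

  combine : ∀ E u v r y → (u ℚ.* 1ℚ ℚ.+ v ℚ.* r) ℚ.* (E ℚ.* y) ≡ u ℚ.* (E ℚ.* y) ℚ.+ v ℚ.* (E ℚ.* (r ℚ.* y))
  combine = solve 5 (λ E u v r y → (u :* con 1ℚ :+ v :* r) :* (E :* y) := u :* (E :* y) :+ v :* (E :* (r :* y))) refl

  reduced : ∀ E → (∀ j → IsInteger ([ E ] ℚ.* r ^ℚ j)) → ∀ j → IsInteger ([ E ] ℚ.* g ℚ.* r ^ℚ j)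
  reduced E integral j = subst IsInteger
    (sym (trans (distribute [ E ] g (r ^ℚ j)) (trans (cong (ℚ._* ([ E ] ℚ.* r ^ℚ j)) g≡)
      (combine [ E ] [ u ] [ v ] r (r ^ℚ j)))))
    (integer-+ (integer-* (u , refl) (integral j)) (integer-* (v , refl) (integral (suc j))))

  go : ∀ E → E ≢ ℤ.0ℤ → (∀ j → IsInteger ([ E ] ℚ.* r ^ℚ j)) → Acc _<_ ℤ.∣ E ∣ → IsInteger r
  go E E≢0 integral (acc smaller) = continue (reduced E integral 0)
    where
    continue : IsInteger ([ E ] ℚ.* g ℚ.* 1ℚ) → IsInteger r
    continue (E′ , e) = compare ℤ.∣ a ∣ refl
      where
      Eg≡E′ : [ E ] ℚ.* g ≡ [ E′ ]
      Eg≡E′ = trans (sym (ℚ.*-identityʳ _)) e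

      E≡aE′ : E ≡ a ℤ.* E′
      E≡aE′ = []-injective (begin
        [ E ]                        ≡⟨ sym (ℚ.*-identityʳ [ E ]) ⟩
        [ E ] ℚ.* 1ℚ                 ≡⟨ cong ([ E ] ℚ.*_) 1≡ag ⟩
        [ E ] ℚ.* ([ a ] ℚ.* g)      ≡⟨ solve 3 (λ E a g → E :* (a :* g) := a :* (E :* g)) refl [ E ] [ a ] g ⟩
        [ a ] ℚ.* ([ E ] ℚ.* g)      ≡⟨ cong ([ a ] ℚ.*_) Eg≡E′ ⟩
        [ a ] ℚ.* [ E′ ]             ≡⟨ sym ([]-* a E′) ⟩
        [ a ℤ.* E′ ]                 ∎)

      ∣E∣≡ : ∀ {k} → k ≡ ℤ.∣ a ∣ → ℤ.∣ E ∣ ≡ k ℕ.* ℤ.∣ E′ ∣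
      ∣E∣≡ refl = trans (cong ℤ.∣_∣ E≡aE′) (ℤ.abs-* a E′)

      E′≢0 : E′ ≢ ℤ.0ℤ
      E′≢0 refl = E≢0 (trans E≡aE′ (ℤ.*-zeroʳ a))

      -- If |a| is 0 then E = 0, if it is 1 then r is an integer, and otherwise |E′| < |E|.
      compare : ∀ k → k ≡ ℤ.∣ a ∣ → IsInteger r
      compare 0 p = contradiction (ℤ.∣i∣≡0⇒i≡0 (∣E∣≡ p)) E≢0
      compare 1 p = unit-denominator a b (sym p) 1≡ag
      compare (suc (suc k)) p = go E′ E′≢0
        (λ j → subst (λ x → IsInteger (x ℚ.* r ^ℚ j)) Eg≡E′ (reduced E integral j))
        (smaller (subst (ℤ.∣ E′ ∣ <_) (sym (∣E∣≡ p)) (ℕ.m<m+n ℤ.∣ E′ ∣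
          (ℕ.m≤n⇒m≤n+o (k ℕ.* ℤ.∣ E′ ∣) (ℕ.n≢0⇒n>0 λ z → E′≢0 (ℤ.∣i∣≡0⇒i≡0 z))))))

-- With s = b / a in lowest terms, a² divides d b² and hence d. The application is to twice the
-- √d-coordinate of an integral element.
squarefree·square⇒integer : ∀ {d} → SquareFree d → ∀ s → IsInteger ([ + d ] ℚ.* (s ℚ.* s)) → IsInteger s
squarefree·square⇒integer {d} squarefree s (k , ds²≡k) with ℚ-gcd 1ℚ s
... | g , (a , 1≡ag) , (b , refl) , u , v , g≡ = unit-denominator a b ∣a∣≡1 1≡ag
  where
  open +-*-Solver

  D = [ + d ]

  b≡as : [ b ] ≡ [ a ] ℚ.* s
  b≡as = begin
    [ b ]                      ≡⟨ sym (ℚ.*-identityʳ [ b ]) ⟩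
    [ b ] ℚ.* 1ℚ               ≡⟨ cong ([ b ] ℚ.*_) 1≡ag ⟩
    [ b ] ℚ.* ([ a ] ℚ.* g)    ≡⟨ solve 3 (λ b a g → b :* (a :* g) := a :* (b :* g)) refl [ b ] [ a ] g ⟩
    [ a ] ℚ.* s                ∎

  db²≡ka² : + d ℤ.* (b ℤ.* b) ≡ k ℤ.* (a ℤ.* a)
  db²≡ka² = []-injective (begin
    [ + d ℤ.* (b ℤ.* b) ]                       ≡⟨ trans ([]-* (+ d) (b ℤ.* b)) (cong (D ℚ.*_) ([]-* b b)) ⟩
    D ℚ.* ([ b ] ℚ.* [ b ])                     ≡⟨ cong (λ x → D ℚ.* (x ℚ.* x)) b≡as ⟩
    D ℚ.* ([ a ] ℚ.* s ℚ.* ([ a ] ℚ.* s))       ≡⟨ solve 3 (λ D a s → D :* (a :* s :* (a :* s))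
                                                     := D :* (s :* s) :* (a :* a)) refl D [ a ] s ⟩
    D ℚ.* (s ℚ.* s) ℚ.* ([ a ] ℚ.* [ a ])       ≡⟨ cong₂ ℚ._*_ ds²≡k (sym ([]-* a a)) ⟩
    [ k ] ℚ.* [ a ℤ.* a ]                       ≡⟨ sym ([]-* k (a ℤ.* a)) ⟩
    [ k ℤ.* (a ℤ.* a) ]                         ∎)

  1≡ua+vb : ℤ.1ℤ ≡ u ℤ.* a ℤ.+ v ℤ.* b
  1≡ua+vb = []-injective (begin
    1ℚ                                              ≡⟨ 1≡ag ⟩
    [ a ] ℚ.* g                                     ≡⟨ cong ([ a ] ℚ.*_) g≡ ⟩
    [ a ] ℚ.* ([ u ] ℚ.* 1ℚ ℚ.+ [ v ] ℚ.* s)        ≡⟨ solve 4 (λ a u v s → a :* (u :* con 1ℚ :+ v :* s)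
                                                         := u :* a :+ v :* (a :* s)) refl [ a ] [ u ] [ v ] s ⟩
    [ u ] ℚ.* [ a ] ℚ.+ [ v ] ℚ.* ([ a ] ℚ.* s)     ≡⟨ cong (λ x → [ u ] ℚ.* [ a ] ℚ.+ [ v ] ℚ.* x) (sym b≡as) ⟩
    [ u ] ℚ.* [ a ] ℚ.+ [ v ] ℚ.* [ b ]             ≡⟨ cong₂ ℚ._+_ (sym ([]-* u a)) (sym ([]-* v b)) ⟩
    [ u ℤ.* a ] ℚ.+ [ v ℤ.* b ]                     ≡⟨ sym ([]-+ (u ℤ.* a) (v ℤ.* b)) ⟩
    [ u ℤ.* a ℤ.+ v ℤ.* b ]                         ∎)

  -- d = d (ua + vb)³, and each term of the cube is a multiple of a² or of b².
  ∣a∣≡1 : ℤ.∣ a ∣ ≡ 1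
  ∣a∣≡1 = squarefree ℤ.∣ a ∣ (divides ℤ.∣ c ∣ (trans (cong ℤ.∣_∣ d≡) (trans (ℤ.abs-* c (a ℤ.* a))
            (cong (ℤ.∣ c ∣ ℕ.*_) (ℤ.abs-* a a)))))
    where
    A B c : ℤ
    A = u ℤ.* u ℤ.* (u ℤ.* a ℤ.+ (+ 3) ℤ.* v ℤ.* b)
    B = v ℤ.* v ℤ.* ((+ 3) ℤ.* u ℤ.* a ℤ.+ v ℤ.* b)
    c = + d ℤ.* A ℤ.+ k ℤ.* B

    one : ∀ d → d ≡ d ℤ.* (ℤ.1ℤ ℤ.* ℤ.1ℤ ℤ.* ℤ.1ℤ)
    one = ℤSolver.solve-∀

    expand : ∀ d u v a b →
      d ℤ.* ((u ℤ.* a ℤ.+ v ℤ.* b) ℤ.* (u ℤ.* a ℤ.+ v ℤ.* b) ℤ.* (u ℤ.* a ℤ.+ v ℤ.* b))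
      ≡ d ℤ.* (u ℤ.* u ℤ.* (u ℤ.* a ℤ.+ (+ 3) ℤ.* v ℤ.* b)) ℤ.* (a ℤ.* a)
        ℤ.+ v ℤ.* v ℤ.* ((+ 3) ℤ.* u ℤ.* a ℤ.+ v ℤ.* b) ℤ.* (d ℤ.* (b ℤ.* b))
    expand = ℤSolver.solve-∀

    collect : ∀ x y k s → x ℤ.* s ℤ.+ y ℤ.* (k ℤ.* s) ≡ (x ℤ.+ k ℤ.* y) ℤ.* s
    collect = ℤSolver.solve-∀

    d≡ : + d ≡ c ℤ.* (a ℤ.* a)
    d≡ = begin
      + d                                                   ≡⟨ one (+ d) ⟩
      + d ℤ.* (ℤ.1ℤ ℤ.* ℤ.1ℤ ℤ.* ℤ.1ℤ)                      ≡⟨ cong (λ w → + d ℤ.* (w ℤ.* w ℤ.* w)) 1≡ua+vb ⟩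
      + d ℤ.* (w ℤ.* w ℤ.* w)                               ≡⟨ expand (+ d) u v a b ⟩
      + d ℤ.* A ℤ.* (a ℤ.* a) ℤ.+ B ℤ.* (+ d ℤ.* (b ℤ.* b))  ≡⟨ cong (λ x → + d ℤ.* A ℤ.* (a ℤ.* a) ℤ.+ B ℤ.* x) db²≡ka² ⟩
      + d ℤ.* A ℤ.* (a ℤ.* a) ℤ.+ B ℤ.* (k ℤ.* (a ℤ.* a))   ≡⟨ collect (+ d ℤ.* A) B k (a ℤ.* a) ⟩
      c ℤ.* (a ℤ.* a)                                       ∎
      where
      w : ℤ
      w = u ℤ.* a ℤ.+ v ℤ.* b

clear-denominator : ∀ r → [ ↧ r ] ℚ.* r ≡ [ ↥ r ]
clear-denominator r@(mkℚ k n _) = begin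
  [ + suc n ] ℚ.* r                                ≡⟨ cong ([ + suc n ] ℚ.*_) (↥*1/↧ r) ⟩
  [ + suc n ] ℚ.* ([ k ] ℚ.* ((+ 1) ℚ./ suc n))    ≡⟨ swap [ + suc n ] [ k ] ((+ 1) ℚ./ suc n) ⟩
  [ k ] ℚ.* ([ + suc n ] ℚ.* ((+ 1) ℚ./ suc n))    ≡⟨ cong ([ k ] ℚ.*_) (n*1/n n) ⟩
  [ k ] ℚ.* 1ℚ                                     ≡⟨ ℚ.*-identityʳ [ k ] ⟩
  [ k ]                                            ∎
  where
  open +-*-Solver
  swap : ∀ a b c → a ℚ.* (b ℚ.* c) ≡ b ℚ.* (a ℚ.* c)
  swap = solve 3 (λ a b c → a :* (b :* c) := b :* (a :* c)) refl

*-≢0 : ∀ {i j} → i ≢ ℤ.0ℤ → j ≢ ℤ.0ℤ → i ℤ.* j ≢ ℤ.0ℤ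
*-≢0 {i} i≢0 j≢0 e = [ i≢0 , j≢0 ]′ (ℤ.i*j≡0⇒i≡0∨j≡0 i e)

-- Traces and norms of integral elements

module IntegralElements (d : ℤ) where

  open QuadraticField d hiding (zero)
  open ℚ√d
  open CommutativeRing +-*-commutativeRing using
    (commutativeSemiring; *-assoc; *-identityˡ; *-identityʳ; zeroˡ; zeroʳ; +-identityˡ; distribˡ; -‿inverseʳ)

  infixr 8 _^√_

  _^√_ : ℚ√d → ℕ → ℚ√d
  x ^√ zero = 1#
  x ^√ suc j = x * x ^√ j

  ι-^ : ∀ r j → ι r ^√ j ≡ ι (r ^ℚ j)
  ι-^ r zero = refl
  ι-^ r (suc j) = trans (cong (ι r *_) (ι-^ r j)) (sym (ι-* r (r ^ℚ j)))

  conj-+ : ∀ x y → conj (x + y) ≡ conj x + conj y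
  conj-+ x y = cong (re x ℚ.+ re y +√_) (ℚ.neg-distrib-+ (im x) (im y))

  conj-* : ∀ x y → conj (x * y) ≡ conj x * conj y
  conj-* x y = cong₂ _+√_ (re≡ dℚ (re x) (im x) (re y) (im y)) (im≡ (re x) (im x) (re y) (im y))
    where
    open +-*-Solver
    re≡ : ∀ D a b a′ b′ → a ℚ.* a′ ℚ.+ D ℚ.* (b ℚ.* b′) ≡ a ℚ.* a′ ℚ.+ D ℚ.* (ℚ.- b ℚ.* ℚ.- b′)
    re≡ = solve 5 (λ D a b c e → a :* c :+ D :* (b :* e) := a :* c :+ D :* (:- b :* :- e)) refl
    im≡ : ∀ a b a′ b′ → ℚ.- (a ℚ.* b′ ℚ.+ b ℚ.* a′) ≡ a ℚ.* ℚ.- b′ ℚ.+ ℚ.- b ℚ.* a′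
    im≡ = solve 4 (λ a b c e → :- (a :* e :+ b :* c) := a :* :- e :+ :- b :* c) refl

  monicValue-conj : ∀ cs x → monicValue cs (conj x) ≡ conj (monicValue cs x)
  monicValue-conj [] x = refl
  monicValue-conj (c ∷ cs) x = begin
    fromℤ c + conj x * monicValue cs (conj x)      ≡⟨ cong (λ y → fromℤ c + conj x * y) (monicValue-conj cs x) ⟩
    fromℤ c + conj x * conj (monicValue cs x)      ≡⟨ cong (λ y → fromℤ c + y) (sym (conj-* x (monicValue cs x))) ⟩
    fromℤ c + conj (x * monicValue cs x)           ≡⟨ sym (conj-+ (fromℤ c) (x * monicValue cs x)) ⟩
    conj (fromℤ c + x * monicValue cs x)           ∎

  -- The order ℤ[√d], in general smaller than the ring of integers; it serves to measure
  -- denominators.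
  ℤ√d : Pred ℚ√d 0ℓ
  ℤ√d x = IsInteger (re x) × IsInteger (im x)

  ℤ√d-0 : ℤ√d 0#
  ℤ√d-0 = (ℤ.0ℤ , refl) , (ℤ.0ℤ , refl)

  ℤ√d-+ : ∀ {x y} → ℤ√d x → ℤ√d y → ℤ√d (x + y)
  ℤ√d-+ (a , b) (a′ , b′) = integer-+ a a′ , integer-+ b b′

  ℤ√d-* : ∀ {x y} → ℤ√d x → ℤ√d y → ℤ√d (x * y)
  ℤ√d-* (a , b) (a′ , b′) = integer-+ (integer-* a a′) (integer-* (d , refl) (integer-* b b′))
                          , integer-+ (integer-* a b′) (integer-* b a′)

  ℤ√d-fromℤ : ∀ k → ℤ√d (fromℤ k)
  ℤ√d-fromℤ k = (k , refl) , (ℤ.0ℤ , refl)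

  ℤ√d-conj : ∀ {x} → ℤ√d x → ℤ√d (conj x)
  ℤ√d-conj (a , b) = a , integer-neg b

  ι-scale : ∀ r x → ι r * x ≡ (r ℚ.* re x +√ r ℚ.* im x)
  ι-scale r x = cong₂ _+√_ (re≡ dℚ r (re x) (im x)) (im≡ r (re x) (im x))
    where
    open +-*-Solver
    re≡ : ∀ D r a b → r ℚ.* a ℚ.+ D ℚ.* (0ℚ ℚ.* b) ≡ r ℚ.* a
    re≡ = solve 4 (λ D r a b → r :* a :+ D :* (con 0ℚ :* b) := r :* a) refl
    im≡ : ∀ r a b → r ℚ.* b ℚ.+ 0ℚ ℚ.* a ≡ r ℚ.* b
    im≡ = solve 3 (λ r a b → r :* b :+ con 0ℚ :* a := r :* b) refl

  fromℤ-* : ∀ i j → fromℤ (i ℤ.* j) ≡ fromℤ i * fromℤ j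
  fromℤ-* i j = trans (cong ι ([]-* i j)) (ι-* [ i ] [ j ])

  open SemiringSolver commutativeSemiring

  clear-denominators : ∀ x → ∃ λ E → E ≢ ℤ.0ℤ × ℤ√d (fromℤ E * x)
  clear-denominators x@(a@(mkℚ i m _) +√ b@(mkℚ j n _)) = + suc m ℤ.* + suc n , (λ ()) ,
    subst ℤ√d (sym (ι-scale [ + suc m ℤ.* + suc n ] x))
      ( (+ suc n ℤ.* i , cleared (+ suc n) a (ℤ.*-comm (+ suc m) (+ suc n)))
      , (+ suc m ℤ.* j , cleared (+ suc m) b refl) )
    where
    cleared : ∀ k r {l} → l ≡ k ℤ.* ↧ r → [ l ] ℚ.* r ≡ [ k ℤ.* ↥ r ]
    cleared k r {l} refl = begin
      [ k ℤ.* ↧ r ] ℚ.* r         ≡⟨ cong (ℚ._* r) ([]-* k (↧ r)) ⟩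
      [ k ] ℚ.* [ ↧ r ] ℚ.* r     ≡⟨ ℚ.*-assoc [ k ] [ ↧ r ] r ⟩
      [ k ] ℚ.* ([ ↧ r ] ℚ.* r)   ≡⟨ cong ([ k ] ℚ.*_) (clear-denominator r) ⟩
      [ k ] ℚ.* [ ↥ r ]           ≡⟨ sym ([]-* k (↥ r)) ⟩
      [ k ℤ.* ↥ r ]               ∎

  common-denominator : ∀ (f : ℕ → ℚ√d) k → ∃ λ E → E ≢ ℤ.0ℤ × (∀ i → i < k → ℤ√d (fromℤ E * f i))
  common-denominator f zero = ℤ.1ℤ , (λ ()) , λ _ ()
  common-denominator f (suc k) =
    let E , E≢0 , below = common-denominator f k
        F , F≢0 , at-k = clear-denominators (f k)
    in E ℤ.* F , *-≢0 E≢0 F≢0 , λ i i<1+k → [ (λ i<k → subst ℤ√d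
          (trans (solve 3 (λ E F y → F :* (E :* y) := E :* F :* y) refl (fromℤ E) (fromℤ F) (f i))
            (cong (_* f i) (sym (fromℤ-* E F))))
          (ℤ√d-* (ℤ√d-fromℤ F) (below i i<k)))
      , (λ { refl → subst ℤ√d
          (trans (solve 3 (λ E F y → E :* (F :* y) := E :* F :* y) refl (fromℤ E) (fromℤ F) (f i))
            (cong (_* f i) (sym (fromℤ-* E F))))
          (ℤ√d-* (ℤ√d-fromℤ E) at-k) }) ]′ (ℕ.m≤n⇒m<n∨m≡n (ℕ.≤-pred i<1+k))

  module _ (P : Pred ℚ√d 0ℓ) (P-0 : P 0#) (P-+ : ∀ {x y} → P x → P y → P (x + y))
           (P-scale : ∀ k {x} → P x → P (fromℤ k * x)) (z : ℚ√d) where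

    shift : ∀ i w → z ^√ i * (z * w) ≡ z ^√ suc i * w
    shift i w = solve 3 (λ y z w → y :* (z :* w) := z :* y :* w) refl (z ^√ i) z w

    -- `P` behaves like an additive group with integer multiples. Subtracting c w from (c + z f) w
    -- leaves f (z w), so the induction along Horner's rule moves one factor z into `w` at each
    -- stage, until only the leading coefficient 1 remains.
    leading-power : ∀ cs w → (∀ i → i < length cs → P (z ^√ i * w)) →
                    P (monicValue cs z * w) → P (z ^√ length cs * w)
    leading-power [] w _ value = value
    leading-power (c ∷ cs) w lower value = subst P (shift (length cs) w) (leading-power cs (z * w)
      (λ i i< → subst P (sym (shift i w)) (lower (suc i) (s≤s i<)))
      (subst P tail (P-+ value (P-scale (ℤ.- c) (lower 0 (s≤s z≤n))))))
      where
      f : ℚ√d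
      f = monicValue cs z

      c-c : fromℤ c + fromℤ (ℤ.- c) ≡ 0#
      c-c = trans (cong (λ y → fromℤ c + y) (cong ι ([]-neg c))) (-‿inverseʳ (fromℤ c))

      tail : (fromℤ c + z * f) * w + fromℤ (ℤ.- c) * (1# * w) ≡ f * (z * w)
      tail = begin
        (fromℤ c + z * f) * w + fromℤ (ℤ.- c) * (1# * w)  ≡⟨ solve 5 (λ c z f w c′ → (c :+ z :* f) :* w :+ c′ :* (con 1 :* w)
                                                               := (c :+ c′) :* w :+ f :* (z :* w))
                                                               refl (fromℤ c) z f w (fromℤ (ℤ.- c)) ⟩
        (fromℤ c + fromℤ (ℤ.- c)) * w + f * (z * w)       ≡⟨ cong (λ u → u * w + f * (z * w)) c-c ⟩
        0# * w + f * (z * w)                              ≡⟨ cong (λ u → u + f * (z * w)) (zeroˡ w) ⟩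
        0# + f * (z * w)                                  ≡⟨ +-identityˡ (f * (z * w)) ⟩
        f * (z * w)                                       ∎

    module _ (cs : List ℤ) (root : monicValue cs z ≡ 0#) where

      powers≤degree : ∀ w → (∀ i → i < length cs → P (z ^√ i * w)) → ∀ i → i ≤ length cs → P (z ^√ i * w)
      powers≤degree w lower i i≤ = [ lower i , (λ { refl → leading-power cs w lower
        (subst P (sym (trans (cong (_* w) root) (zeroˡ w))) P-0) }) ]′ (ℕ.m≤n⇒m<n∨m≡n i≤)

      -- A window of consecutive powers, as long as the degree, slides upwards: if it lies in `P`
      -- for `w`, then it does so for `z * w`.
      all-powers : ∀ w → (∀ i → i < length cs → P (z ^√ i * w)) → ∀ j → P (z ^√ j * w)
      all-powers w lower zero = powers≤degree w lower 0 z≤n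
      all-powers w lower (suc j) = subst P (shift j w) (all-powers (z * w)
        (λ i i< → subst P (sym (shift i w)) (powers≤degree w lower (suc i) i<)) j)

  powers-bounded : ∀ {z} → Integral z → ∃ λ E → E ≢ ℤ.0ℤ × (∀ j → ℤ√d (fromℤ E * z ^√ j))
  powers-bounded {z} (cs , root) =
    let E , E≢0 , lower = common-denominator (z ^√_) (length cs) in
    E , E≢0 , λ j → subst (λ u → ℤ√d (fromℤ E * u)) (*-identityʳ (z ^√ j))
      (all-powers (λ x → ℤ√d (fromℤ E * x))
        (subst ℤ√d (sym (zeroʳ (fromℤ E))) ℤ√d-0)
        (λ {x} {y} p q → subst ℤ√d (sym (distribˡ (fromℤ E) x y)) (ℤ√d-+ p q))
        (λ k {x} p → subst ℤ√d (solve 3 (λ k E x → k :* (E :* x) := E :* (k :* x)) refl (fromℤ k) (fromℤ E) x)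
          (ℤ√d-* (ℤ√d-fromℤ k) p))
        z cs root 1# (λ i i< → subst (λ u → ℤ√d (fromℤ E * u)) (sym (*-identityʳ (z ^√ i))) (lower i i<)) j)

  conj-^ : ∀ x j → conj (x ^√ j) ≡ conj x ^√ j
  conj-^ x zero = refl
  conj-^ x (suc j) = trans (conj-* x (x ^√ j)) (cong (conj x *_) (conj-^ x j))

  -- Bounded denominators take the place of a minimal polynomial. The monomials in z and its
  -- conjugate have denominators dividing E², hence so do all powers of the trace and of the norm,
  -- which are integer polynomials in the two. A rational number with such powers is an integer.
  trace-norm-integer : ∀ {z} → Integral z → IsInteger (re z ℚ.+ re z) × IsInteger (norm z)
  trace-norm-integer {z} z-integral = conclude (powers-bounded z-integral)
    where
    z̄ : ℚ√d
    z̄ = conj z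

    trace≡ : ι (re z ℚ.+ re z) ≡ z + z̄
    trace≡ = cong (re z ℚ.+ re z +√_) (sym (ℚ.+-inverseʳ (im z)))

    conclude : (∃ λ E → E ≢ ℤ.0ℤ × (∀ j → ℤ√d (fromℤ E * z ^√ j))) → IsInteger (re z ℚ.+ re z) × IsInteger (norm z)
    conclude (E , E≢0 , bounded) =
        integer (re z ℚ.+ re z) (λ {x} p → subst P (cong (_* x) (sym trace≡)) (P-trace p))
      , integer (norm z) (λ {x} p → subst P (cong (_* x) (x*conj-x z)) (P-norm p))
      where
      -- Quantifying over all monomials makes `P` stable under multiplication by z and by its
      -- conjugate: just shift `i` or `j`.
      P : Pred ℚ√d 0ℓ
      P w = ∀ i j → ℤ√d (fromℤ (E ℤ.* E) * (z ^√ i * (z̄ ^√ j * w)))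

      bounded-conj : ∀ j → ℤ√d (fromℤ E * z̄ ^√ j)
      bounded-conj j = subst ℤ√d (trans (conj-* (fromℤ E) (z ^√ j))
        (cong (fromℤ E *_) (conj-^ z j))) (ℤ√d-conj (bounded j))

      P-1 : P 1#
      P-1 i j = subst ℤ√d (trans (solve 3 (λ E x y → E :* x :* (E :* y) := E :* E :* (x :* (y :* con 1))) refl
          (fromℤ E) (z ^√ i) (z̄ ^√ j))
        (cong (_* (z ^√ i * (z̄ ^√ j * 1#))) (sym (fromℤ-* E E)))) (ℤ√d-* (bounded i) (bounded-conj j))

      P-z : ∀ {w} → P w → P (z * w)
      P-z {w} p i j = subst ℤ√d (solve 5 (λ E z x y w → E :* (z :* x :* (y :* w)) := E :* (x :* (y :* (z :* w)))) refl
        (fromℤ (E ℤ.* E)) z (z ^√ i) (z̄ ^√ j) w) (p (suc i) j)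

      P-z̄ : ∀ {w} → P w → P (z̄ * w)
      P-z̄ {w} p i j = subst ℤ√d (solve 5 (λ E z x y w → E :* (x :* (z :* y :* w)) := E :* (x :* (y :* (z :* w)))) refl
        (fromℤ (E ℤ.* E)) z̄ (z ^√ i) (z̄ ^√ j) w) (p i (suc j))

      P-trace : ∀ {w} → P w → P ((z + z̄) * w)
      P-trace {w} p i j = subst ℤ√d (solve 6 (λ E x y z z̄ w → E :* (x :* (y :* (z :* w))) :+ E :* (x :* (y :* (z̄ :* w)))
          := E :* (x :* (y :* ((z :+ z̄) :* w)))) refl (fromℤ (E ℤ.* E)) (z ^√ i) (z̄ ^√ j) z z̄ w)
        (ℤ√d-+ (P-z p i j) (P-z̄ p i j))

      P-norm : ∀ {w} → P w → P ((z * z̄) * w)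
      P-norm {w} p = subst P (sym (*-assoc z z̄ w)) (P-z (P-z̄ p))

      integer : ∀ r → (∀ {w} → P w → P (ι r * w)) → IsInteger r
      integer r P-r = bounded-denominators⇒integer (E ℤ.* E) r (*-≢0 E≢0 E≢0) λ j →
        subst IsInteger (cong re (begin
          fromℤ (E ℤ.* E) * (1# * (1# * ι r ^√ j))  ≡⟨ cong (fromℤ (E ℤ.* E) *_) (trans (*-identityˡ _) (*-identityˡ _)) ⟩
          fromℤ (E ℤ.* E) * ι r ^√ j                ≡⟨ cong (fromℤ (E ℤ.* E) *_) (ι-^ r j) ⟩
          ι [ E ℤ.* E ] * ι (r ^ℚ j)                 ≡⟨ sym (ι-* [ E ℤ.* E ] (r ^ℚ j)) ⟩
          ι ([ E ℤ.* E ] ℚ.* r ^ℚ j)                 ∎))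
          (proj₁ (P-power j 0 0))
        where
        P-power : ∀ j → P (ι r ^√ j)
        P-power zero = P-1
        P-power (suc j) = P-r (P-power j)

-- The ideals ℤm + ℤω

module RingOfIntegers (d : ℕ) (M : ℤ) (d≡4M+1 : + d ≡ (+ 4) ℤ.* M ℤ.+ ℤ.1ℤ) (squarefree : SquareFree d) where

  open QuadraticField (+ d)
  open ℚ√d
  open IsSubmodule
  open FractionalIdeal
  open IntegralElements (+ d)
  open CommutativeRing +-*-commutativeRing using
    (commutativeSemiring; *-assoc; *-identityˡ; *-identityʳ)

  D≡4M+1 : dℚ ≡ [ + 4 ] ℚ.* [ M ] ℚ.+ 1ℚ
  D≡4M+1 = trans (cong [_] d≡4M+1) (trans ([]-+ ((+ 4) ℤ.* M) ℤ.1ℤ) (cong (ℚ._+ 1ℚ) ([]-* (+ 4) M)))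

  -- ⟨ u , v ⟩ is u + vω, where ω = (1 + √d) / 2 satisfies ω² = ω + M.
  abstract
    ⟨_,_⟩ : ℤ → ℤ → ℚ√d
    ⟨ u , v ⟩ = [ u ] ℚ.+ ½ ℚ.* [ v ] +√ ½ ℚ.* [ v ]

    ⟨⟩-injective : ∀ {u v u′ v′} → ⟨ u , v ⟩ ≡ ⟨ u′ , v′ ⟩ → u ≡ u′ × v ≡ v′
    ⟨⟩-injective {u} {v} {u′} {v′} e =
        []-injective (trans (trans (unshift [ u ] [ v ]) (cong (λ x → re x ℚ.- im x) e)) (sym (unshift [ u′ ] [ v′ ])))
      , []-injective (trans (trans (double [ v ]) (cong (λ x → im x ℚ.+ im x) e)) (sym (double [ v′ ])))
      where
      open +-*-Solver
      unshift : ∀ u v → u ≡ u ℚ.+ ½ ℚ.* v ℚ.- ½ ℚ.* v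
      unshift = solve 2 (λ u v → u := u :+ con ½ :* v :- con ½ :* v) refl
      double : ∀ v → v ≡ ½ ℚ.* v ℚ.+ ½ ℚ.* v
      double = solve 1 (λ v → v := con ½ :* v :+ con ½ :* v) refl

    ⟨⟩-+ : ∀ u v u′ v′ → ⟨ u , v ⟩ + ⟨ u′ , v′ ⟩ ≡ ⟨ u ℤ.+ u′ , v ℤ.+ v′ ⟩
    ⟨⟩-+ u v u′ v′ = sym (cong₂ _+√_
      (trans (cong₂ (λ x y → x ℚ.+ ½ ℚ.* y) ([]-+ u u′) ([]-+ v v′)) (re≡ [ u ] [ v ] [ u′ ] [ v′ ]))
      (trans (cong (½ ℚ.*_) ([]-+ v v′)) (ℚ.*-distribˡ-+ ½ [ v ] [ v′ ])))
      where
      open +-*-Solver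
      re≡ : ∀ u v u′ v′ → u ℚ.+ u′ ℚ.+ ½ ℚ.* (v ℚ.+ v′) ≡ (u ℚ.+ ½ ℚ.* v) ℚ.+ (u′ ℚ.+ ½ ℚ.* v′)
      re≡ = solve 4 (λ u v a b → u :+ a :+ con ½ :* (v :+ b) := (u :+ con ½ :* v) :+ (a :+ con ½ :* b)) refl

    ⟨⟩-* : ∀ u v u′ v′ → ⟨ u , v ⟩ * ⟨ u′ , v′ ⟩ ≡
           ⟨ u ℤ.* u′ ℤ.+ M ℤ.* (v ℤ.* v′) , u ℤ.* v′ ℤ.+ v ℤ.* u′ ℤ.+ v ℤ.* v′ ⟩
    ⟨⟩-* u v u′ v′ = cong₂ _+√_
      (begin
        a ℚ.* a′ ℚ.+ dℚ ℚ.* (b ℚ.* b′)                           ≡⟨ cong (λ D → a ℚ.* a′ ℚ.+ D ℚ.* (b ℚ.* b′)) D≡4M+1 ⟩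
        a ℚ.* a′ ℚ.+ ([ + 4 ] ℚ.* [ M ] ℚ.+ 1ℚ) ℚ.* (b ℚ.* b′)   ≡⟨ re≡ [ M ] [ u ] [ v ] [ u′ ] [ v′ ] ⟩
        _                                                        ≡⟨ sym (cong₂ (λ x y → x ℚ.+ ½ ℚ.* y) X≡ Y≡) ⟩
        _                                                        ∎)
      (trans (im≡ [ u ] [ v ] [ u′ ] [ v′ ]) (cong (½ ℚ.*_) (sym Y≡)))
      where
      open +-*-Solver
      a b a′ b′ : ℚ
      a = [ u ] ℚ.+ ½ ℚ.* [ v ]
      b = ½ ℚ.* [ v ]
      a′ = [ u′ ] ℚ.+ ½ ℚ.* [ v′ ]
      b′ = ½ ℚ.* [ v′ ]

      X≡ : [ u ℤ.* u′ ℤ.+ M ℤ.* (v ℤ.* v′) ] ≡ [ u ] ℚ.* [ u′ ] ℚ.+ [ M ] ℚ.* ([ v ] ℚ.* [ v′ ])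
      X≡ = trans ([]-+ (u ℤ.* u′) (M ℤ.* (v ℤ.* v′)))
             (cong₂ ℚ._+_ ([]-* u u′) (trans ([]-* M (v ℤ.* v′)) (cong ([ M ] ℚ.*_) ([]-* v v′))))

      Y≡ : [ u ℤ.* v′ ℤ.+ v ℤ.* u′ ℤ.+ v ℤ.* v′ ] ≡ [ u ] ℚ.* [ v′ ] ℚ.+ [ v ] ℚ.* [ u′ ] ℚ.+ [ v ] ℚ.* [ v′ ]
      Y≡ = trans ([]-+ (u ℤ.* v′ ℤ.+ v ℤ.* u′) (v ℤ.* v′)) (cong₂ ℚ._+_
             (trans ([]-+ (u ℤ.* v′) (v ℤ.* u′)) (cong₂ ℚ._+_ ([]-* u v′) ([]-* v u′))) ([]-* v v′))

      re≡ : ∀ M u v u′ v′ →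
        (u ℚ.+ ½ ℚ.* v) ℚ.* (u′ ℚ.+ ½ ℚ.* v′) ℚ.+ ([ + 4 ] ℚ.* M ℚ.+ 1ℚ) ℚ.* (½ ℚ.* v ℚ.* (½ ℚ.* v′))
        ≡ u ℚ.* u′ ℚ.+ M ℚ.* (v ℚ.* v′) ℚ.+ ½ ℚ.* (u ℚ.* v′ ℚ.+ v ℚ.* u′ ℚ.+ v ℚ.* v′)
      re≡ = solve 5 (λ M u v a b →
        (u :+ con ½ :* v) :* (a :+ con ½ :* b) :+ (con [ + 4 ] :* M :+ con 1ℚ) :* (con ½ :* v :* (con ½ :* b))
        := u :* a :+ M :* (v :* b) :+ con ½ :* (u :* b :+ v :* a :+ v :* b)) refl

      im≡ : ∀ u v u′ v′ →
        (u ℚ.+ ½ ℚ.* v) ℚ.* (½ ℚ.* v′) ℚ.+ ½ ℚ.* v ℚ.* (u′ ℚ.+ ½ ℚ.* v′)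
        ≡ ½ ℚ.* (u ℚ.* v′ ℚ.+ v ℚ.* u′ ℚ.+ v ℚ.* v′)
      im≡ = solve 4 (λ u v a b →
        (u :+ con ½ :* v) :* (con ½ :* b) :+ con ½ :* v :* (a :+ con ½ :* b)
        := con ½ :* (u :* b :+ v :* a :+ v :* b)) refl

    fromℤ≡⟨⟩ : ∀ k → fromℤ k ≡ ⟨ k , ℤ.0ℤ ⟩
    fromℤ≡⟨⟩ k = cong (_+√ 0ℚ) (sym (ℚ.+-identityʳ [ k ]))

    -- Outside the `abstract` block `⟨_,_⟩` does not unfold; this lemma lets explicit rational
    -- coordinates be recognised there.
    +√≡⟨⟩ : ∀ {a b} u v → a ≡ [ u ] ℚ.+ ½ ℚ.* [ v ] → b ≡ ½ ℚ.* [ v ] → (a +√ b) ≡ ⟨ u , v ⟩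
    +√≡⟨⟩ u v = cong₂ _+√_

  ω : ℚ√d
  ω = ⟨ ℤ.0ℤ , ℤ.1ℤ ⟩

  ω̄ : ℚ√d
  ω̄ = ⟨ ℤ.1ℤ , ℤ.-1ℤ ⟩

  ω-integral : Integral ω
  ω-integral = quadratic-integral ℤ.1ℤ (ℤ.- M) {z′ = ω̄}
    (trans (⟨⟩-+ ℤ.0ℤ ℤ.1ℤ ℤ.1ℤ ℤ.-1ℤ) (sym (fromℤ≡⟨⟩ ℤ.1ℤ)))
    (trans (⟨⟩-* ℤ.0ℤ ℤ.1ℤ ℤ.1ℤ ℤ.-1ℤ) (trans (cong ⟨_, ℤ.0ℤ ⟩ (eq M)) (sym (fromℤ≡⟨⟩ (ℤ.- M)))))
    where
    eq : ∀ M → ℤ.0ℤ ℤ.* ℤ.1ℤ ℤ.+ M ℤ.* (ℤ.1ℤ ℤ.* ℤ.-1ℤ) ≡ ℤ.- M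
    eq = ℤSolver.solve-∀

  ⟨⟩≡ : ∀ u v → ⟨ u , v ⟩ ≡ fromℤ u + fromℤ v * ω
  ⟨⟩≡ u v = sym (begin
    fromℤ u + fromℤ v * ω                              ≡⟨ cong₂ (λ x y → x + y * ω) (fromℤ≡⟨⟩ u) (fromℤ≡⟨⟩ v) ⟩
    ⟨ u , ℤ.0ℤ ⟩ + ⟨ v , ℤ.0ℤ ⟩ * ω                    ≡⟨ cong (λ y → ⟨ u , ℤ.0ℤ ⟩ + y) (⟨⟩-* v ℤ.0ℤ ℤ.0ℤ ℤ.1ℤ) ⟩
    ⟨ u , ℤ.0ℤ ⟩ + _                                   ≡⟨ ⟨⟩-+ u ℤ.0ℤ _ _ ⟩
    _                                                  ≡⟨ cong₂ ⟨_,_⟩ (re≡ M u v) (im≡ v) ⟩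
    ⟨ u , v ⟩                                          ∎)
    where
    re≡ : ∀ M u v → u ℤ.+ (v ℤ.* ℤ.0ℤ ℤ.+ M ℤ.* (ℤ.0ℤ ℤ.* ℤ.1ℤ)) ≡ u
    re≡ = ℤSolver.solve-∀
    im≡ : ∀ v → ℤ.0ℤ ℤ.+ (v ℤ.* ℤ.1ℤ ℤ.+ ℤ.0ℤ ℤ.* ℤ.0ℤ ℤ.+ ℤ.0ℤ ℤ.* ℤ.1ℤ) ≡ v
    im≡ = ℤSolver.solve-∀

  ℤ[ω] : Pred ℚ√d 0ℓ
  ℤ[ω] z = ∃₂ λ u v → z ≡ ⟨ u , v ⟩

  -- Modulo 2 the hypothesis makes T² and v² agree, since d is odd. Then (T - v)² is even, and T - v
  -- with it because 2 is prime.
  same-parity : ∀ T v N → + d ℤ.* (v ℤ.* v) ≡ T ℤ.* T ℤ.- (+ 4) ℤ.* N → ∃ λ u → T ≡ v ℤ.+ (u ℤ.+ u)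
  same-parity T v N dv²≡ = conclude (ℤ∣.∣ᵤ⇒∣ {+ 2} 2∣T-v)
    where
    -- Half of (T - v)², once T² is replaced by 4N + (4M + 1) v².
    X : ℤ
    X = (+ 2) ℤ.* (N ℤ.+ M ℤ.* (v ℤ.* v)) ℤ.+ v ℤ.* v ℤ.- T ℤ.* v

    square : ∀ M T v N → (T ℤ.- v) ℤ.* (T ℤ.- v) ≡
      ((+ 2) ℤ.* (N ℤ.+ M ℤ.* (v ℤ.* v)) ℤ.+ v ℤ.* v ℤ.- T ℤ.* v) ℤ.* (+ 2)
        ℤ.+ (T ℤ.* T ℤ.- (+ 4) ℤ.* N ℤ.- ((+ 4) ℤ.* M ℤ.+ ℤ.1ℤ) ℤ.* (v ℤ.* v))
    square = ℤSolver.solve-∀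

    vanish : T ℤ.* T ℤ.- (+ 4) ℤ.* N ℤ.- ((+ 4) ℤ.* M ℤ.+ ℤ.1ℤ) ℤ.* (v ℤ.* v) ≡ ℤ.0ℤ
    vanish = ℤ.i≡j⇒i-j≡0 (trans (sym dv²≡) (cong (ℤ._* (v ℤ.* v)) d≡4M+1))

    2∣[T-v]² : 2 ∣ ℤ.∣ T ℤ.- v ∣ ℕ.* ℤ.∣ T ℤ.- v ∣
    2∣[T-v]² = divides ℤ.∣ X ∣ (trans (sym (ℤ.abs-* (T ℤ.- v) (T ℤ.- v))) (trans
      (cong ℤ.∣_∣ (trans (square M T v N) (trans (cong (λ y → X ℤ.* (+ 2) ℤ.+ y) vanish) (ℤ.+-identityʳ (X ℤ.* (+ 2))))))
      (ℤ.abs-* X (+ 2))))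

    2∣T-v : 2 ∣ ℤ.∣ T ℤ.- v ∣
    2∣T-v = reduce (euclidsLemma ℤ.∣ T ℤ.- v ∣ ℤ.∣ T ℤ.- v ∣ prime[2] 2∣[T-v]²)

    conclude : ℤ∣._∣_ (+ 2) (T ℤ.- v) → ∃ λ u → T ≡ v ℤ.+ (u ℤ.+ u)
    conclude (ℤ∣.divides u e) = u , trans (add-back T v) (trans (cong (λ y → v ℤ.+ y) e) (twice v u))
      where
      add-back : ∀ T v → T ≡ v ℤ.+ (T ℤ.- v)
      add-back = ℤSolver.solve-∀
      twice : ∀ v u → v ℤ.+ u ℤ.* (+ 2) ≡ v ℤ.+ (u ℤ.+ u)
      twice = ℤSolver.solve-∀

  -- For z = a + b√d with trace T = 2a, norm N and v = 2b, the identity d v² = T² - 4N makes d v² an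
  -- integer, and square-freeness makes v one. Parity gives T = v + 2u, that is z = u + vω.
  integral⇒ℤ[ω] : ∀ {z} → Integral z → ℤ[ω] z
  integral⇒ℤ[ω] {a +√ b} z-integral = from-trace-norm (trace-norm-integer z-integral)
    where
    open +-*-Solver

    halve : ∀ a → a ≡ ½ ℚ.* (a ℚ.+ a)
    halve = solve 1 (λ a → a := con ½ :* (a :+ a)) refl

    discriminant : ∀ D a b → D ℚ.* ((b ℚ.+ b) ℚ.* (b ℚ.+ b)) ≡
      (a ℚ.+ a) ℚ.* (a ℚ.+ a) ℚ.- [ + 4 ] ℚ.* (a ℚ.* a ℚ.- D ℚ.* (b ℚ.* b))
    discriminant = solve 3 (λ D a b → D :* ((b :+ b) :* (b :+ b)) :=
      (a :+ a) :* (a :+ a) :- con [ + 4 ] :* (a :* a :- D :* (b :* b))) refl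

    half-sum : ∀ u v → ½ ℚ.* (v ℚ.+ (u ℚ.+ u)) ≡ u ℚ.+ ½ ℚ.* v
    half-sum = solve 2 (λ u v → con ½ :* (v :+ (u :+ u)) := u :+ con ½ :* v) refl

    from-trace-norm : IsInteger (a ℚ.+ a) × IsInteger (norm (a +√ b)) → ℤ[ω] (a +√ b)
    from-trace-norm ((T , 2a≡T) , (N , norm≡N)) =
      from-im (squarefree·square⇒integer squarefree (b ℚ.+ b) (T ℤ.* T ℤ.- (+ 4) ℤ.* N , 4db²≡))
      where
      4db²≡ : dℚ ℚ.* ((b ℚ.+ b) ℚ.* (b ℚ.+ b)) ≡ [ T ℤ.* T ℤ.- (+ 4) ℤ.* N ]
      4db²≡ = begin
        dℚ ℚ.* ((b ℚ.+ b) ℚ.* (b ℚ.+ b))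
          ≡⟨ discriminant dℚ a b ⟩
        (a ℚ.+ a) ℚ.* (a ℚ.+ a) ℚ.- [ + 4 ] ℚ.* norm (a +√ b)
          ≡⟨ cong₂ (λ x y → x ℚ.* x ℚ.- [ + 4 ] ℚ.* y) 2a≡T norm≡N ⟩
        [ T ] ℚ.* [ T ] ℚ.- [ + 4 ] ℚ.* [ N ]
          ≡⟨ cong₂ ℚ._-_ (sym ([]-* T T)) (sym ([]-* (+ 4) N)) ⟩
        [ T ℤ.* T ] ℚ.- [ (+ 4) ℤ.* N ]
          ≡⟨ cong (λ y → [ T ℤ.* T ] ℚ.+ y) (sym ([]-neg ((+ 4) ℤ.* N))) ⟩
        [ T ℤ.* T ] ℚ.+ [ ℤ.- ((+ 4) ℤ.* N) ]
          ≡⟨ sym ([]-+ (T ℤ.* T) (ℤ.- ((+ 4) ℤ.* N))) ⟩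
        [ T ℤ.* T ℤ.- (+ 4) ℤ.* N ]                                               ∎

      from-im : IsInteger (b ℚ.+ b) → ℤ[ω] (a +√ b)
      from-im (v , 2b≡v) = from-parity (same-parity T v N ([]-injective (begin
        [ + d ℤ.* (v ℤ.* v) ]               ≡⟨ trans ([]-* (+ d) (v ℤ.* v)) (cong (dℚ ℚ.*_) ([]-* v v)) ⟩
        dℚ ℚ.* ([ v ] ℚ.* [ v ])            ≡⟨ cong (λ x → dℚ ℚ.* (x ℚ.* x)) (sym 2b≡v) ⟩
        dℚ ℚ.* ((b ℚ.+ b) ℚ.* (b ℚ.+ b))    ≡⟨ 4db²≡ ⟩
        [ T ℤ.* T ℤ.- (+ 4) ℤ.* N ]         ∎)))
        where
        from-parity : (∃ λ u → T ≡ v ℤ.+ (u ℤ.+ u)) → ℤ[ω] (a +√ b)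
        from-parity (u , T≡) = u , v , +√≡⟨⟩ u v
          (begin
            a                                   ≡⟨ halve a ⟩
            ½ ℚ.* (a ℚ.+ a)                     ≡⟨ cong (½ ℚ.*_) (trans 2a≡T (cong [_] T≡)) ⟩
            ½ ℚ.* [ v ℤ.+ (u ℤ.+ u) ]           ≡⟨ cong (½ ℚ.*_) (trans ([]-+ v (u ℤ.+ u)) (cong (λ y → [ v ] ℚ.+ y) ([]-+ u u))) ⟩
            ½ ℚ.* ([ v ] ℚ.+ ([ u ] ℚ.+ [ u ])) ≡⟨ half-sum [ u ] [ v ] ⟩
            [ u ] ℚ.+ ½ ℚ.* [ v ]               ∎)
          (trans (halve b) (cong (½ ℚ.*_) 2b≡v))

  ℤ[ω]-closed : ∀ {I} → IsSubmodule I → ∀ {a x} → ℤ[ω] a → I x → I (a * x)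
  ℤ[ω]-closed {I} I-sub {x = x} (u , v , refl) x∈ = subst I
    (trans (expand (fromℤ u) (fromℤ v) ω x) (cong (_* x) (sym (⟨⟩≡ u v))))
    (+-closed I-sub (·-closed I-sub (fromℤ-integral u) x∈)
      (·-closed I-sub (fromℤ-integral v) (·-closed I-sub ω-integral x∈)))
    where
    open SemiringSolver commutativeSemiring
    expand : ∀ u v w x → u * x + v * (w * x) ≡ (u + v * w) * x
    expand = solve 4 (λ u v w x → u :* x :+ v :* (w :* x) := (u :+ v :* w) :* x) refl

  ℤ[ω]-* : ∀ {x y} → ℤ[ω] x → ℤ[ω] y → ℤ[ω] (x * y)
  ℤ[ω]-* (u , v , refl) (u′ , v′ , refl) = _ , _ , ⟨⟩-* u v u′ v′

  ℤ[ω]-isSubmodule : IsSubmodule ℤ[ω]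
  ℤ[ω]-isSubmodule = record
    { 0∈ = ℤ.0ℤ , ℤ.0ℤ , fromℤ≡⟨⟩ ℤ.0ℤ
    ; +-closed = λ { (u , v , refl) (u′ , v′ , refl) → _ , _ , ⟨⟩-+ u v u′ v′ }
    ; ·-closed = λ a x → ℤ[ω]-* (integral⇒ℤ[ω] a) x }

  unitIdeal≐ℤ[ω] : unitIdeal ≐ ℤ[ω]
  unitIdeal≐ℤ[ω]
    = Span-least ℤ[ω]-isSubmodule (λ { refl → ℤ.1ℤ , ℤ.0ℤ , fromℤ≡⟨⟩ ℤ.1ℤ })
    , λ {z} z∈ → subst unitIdeal (*-identityʳ z) (ℤ[ω]-closed Span-isSubmodule z∈ (gen refl))

  -- An ideal only when m divides M.
  Lattice : ℕ → Pred ℚ√d 0ℓ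
  Lattice m z = ∃₂ λ k v → z ≡ ⟨ k ℤ.* + m , v ⟩

  m∈Lattice : ∀ m → Lattice m (fromℤ (+ m))
  m∈Lattice m = ℤ.1ℤ , ℤ.0ℤ , trans (fromℤ≡⟨⟩ (+ m)) (cong ⟨_, ℤ.0ℤ ⟩ (sym (ℤ.*-identityˡ (+ m))))

  ω∈Lattice : ∀ m → Lattice m ω
  ω∈Lattice m = ℤ.0ℤ , ℤ.1ℤ , refl

  Lattice-isSubmodule : ∀ {m} c → M ≡ c ℤ.* + m → IsSubmodule (Lattice m)
  Lattice-isSubmodule {m} c M≡cm = record
    { 0∈ = ℤ.0ℤ , ℤ.0ℤ , fromℤ≡⟨⟩ ℤ.0ℤ
    ; +-closed = λ { (k , v , refl) (k′ , v′ , refl) → k ℤ.+ k′ , v ℤ.+ v′ ,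
        trans (⟨⟩-+ (k ℤ.* + m) v (k′ ℤ.* + m) v′) (cong ⟨_, v ℤ.+ v′ ⟩ (sym (ℤ.*-distribʳ-+ (+ m) k k′))) }
    ; ·-closed = λ a x → scaled (integral⇒ℤ[ω] a) x }
    where
    factor : ∀ e f k v c m → e ℤ.* (k ℤ.* m) ℤ.+ c ℤ.* m ℤ.* (f ℤ.* v) ≡ (e ℤ.* k ℤ.+ c ℤ.* (f ℤ.* v)) ℤ.* m
    factor = ℤSolver.solve-∀

    scaled : ∀ {a x} → ℤ[ω] a → Lattice m x → Lattice m (a * x)
    scaled (e , f , refl) (k , v , refl) = e ℤ.* k ℤ.+ c ℤ.* (f ℤ.* v) , e ℤ.* v ℤ.+ f ℤ.* (k ℤ.* + m) ℤ.+ f ℤ.* v ,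
      trans (⟨⟩-* e f (k ℤ.* + m) v) (cong ⟨_, e ℤ.* v ℤ.+ f ℤ.* (k ℤ.* + m) ℤ.+ f ℤ.* v ⟩
        (trans (cong (λ M → e ℤ.* (k ℤ.* + m) ℤ.+ M ℤ.* (f ℤ.* v)) M≡cm) (factor e f k v c (+ m))))

  -- The ideal ℤp + ℤω, its inverse and its powers

  module PrimeIdeal (p : ℕ) .{{_ : NonZero p}} (c : ℤ) (M≡cp : M ≡ c ℤ.* + p) where

    private
      1/p : ℚ
      1/p = (+ 1) ℚ./ p

      p*1/p : fromℤ (+ p) * ι 1/p ≡ 1#
      p*1/p = trans (sym (ι-* [ + p ] 1/p)) (cong ι (cancel p))
        where
        cancel : ∀ p .{{_ : NonZero p}} → [ + p ] ℚ.* ((+ 1) ℚ./ p) ≡ 1ℚ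
        cancel (suc n) = n*1/n n

    -- The largest candidate for an inverse, so that one inclusion of the inverse law is immediate.
    -- The other needs only 1 = p (ω̄ / p) + ω, with ω̄ / p and 1 taken from `Colon`.
    Colon : Pred ℚ√d 0ℓ
    Colon y = ∀ x → Lattice p x → ℤ[ω] (x * y)

    1∈Colon : Colon 1#
    1∈Colon _ (k , v , refl) = k ℤ.* + p , v , *-identityʳ ⟨ k ℤ.* + p , v ⟩

    -- Since ω ω̄ = -M = -c p and ω̄ = 1 - ω, the product of kp + vω with ω̄ / p is k ω̄ - c v.
    ω̄/p∈Colon : Colon (ι 1/p * ω̄)
    ω̄/p∈Colon _ (k , v , refl) = k ℤ.- c ℤ.* v , ℤ.- k , (begin
      ⟨ k ℤ.* + p , v ⟩ * (ι 1/p * ω̄)                  ≡⟨ swap ⟨ k ℤ.* + p , v ⟩ (ι 1/p) ω̄ ⟩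
      ι 1/p * (⟨ k ℤ.* + p , v ⟩ * ω̄)                  ≡⟨ cong (ι 1/p *_) (⟨⟩-* (k ℤ.* + p) v ℤ.1ℤ ℤ.-1ℤ) ⟩
      ι 1/p * ⟨ _ , _ ⟩                                ≡⟨ cong (ι 1/p *_) (cong₂ ⟨_,_⟩
          (trans (cong (λ M → k ℤ.* + p ℤ.* ℤ.1ℤ ℤ.+ M ℤ.* (v ℤ.* ℤ.-1ℤ)) M≡cp) (re≡ k (+ p) c v))
          (im≡ k (+ p) v)) ⟩
      ι 1/p * ⟨ (+ p) ℤ.* y , (+ p) ℤ.* ℤ.- k ⟩        ≡⟨ cong (ι 1/p *_) (sym (p-scale y (ℤ.- k))) ⟩
      ι 1/p * (fromℤ (+ p) * ⟨ y , ℤ.- k ⟩)            ≡⟨ regroup (ι 1/p) (fromℤ (+ p)) ⟨ y , ℤ.- k ⟩ ⟩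
      fromℤ (+ p) * ι 1/p * ⟨ y , ℤ.- k ⟩              ≡⟨ cong (_* ⟨ y , ℤ.- k ⟩) p*1/p ⟩
      1# * ⟨ y , ℤ.- k ⟩                               ≡⟨ *-identityˡ ⟨ y , ℤ.- k ⟩ ⟩
      ⟨ y , ℤ.- k ⟩                                    ∎)
      where
      open SemiringSolver commutativeSemiring
      y : ℤ
      y = k ℤ.- c ℤ.* v
      swap : ∀ a b c → a * (b * c) ≡ b * (a * c)
      swap = solve 3 (λ a b c → a :* (b :* c) := b :* (a :* c)) refl
      regroup : ∀ a b c → a * (b * c) ≡ b * a * c
      regroup = solve 3 (λ a b c → a :* (b :* c) := b :* a :* c) refl
      re≡ : ∀ k p c v → k ℤ.* p ℤ.* ℤ.1ℤ ℤ.+ c ℤ.* p ℤ.* (v ℤ.* ℤ.-1ℤ) ≡ p ℤ.* (k ℤ.- c ℤ.* v)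
      re≡ = ℤSolver.solve-∀
      im≡ : ∀ k p v → k ℤ.* p ℤ.* ℤ.-1ℤ ℤ.+ v ℤ.* ℤ.1ℤ ℤ.+ v ℤ.* ℤ.-1ℤ ≡ p ℤ.* ℤ.- k
      im≡ = ℤSolver.solve-∀
      p-scale : ∀ a b → fromℤ (+ p) * ⟨ a , b ⟩ ≡ ⟨ (+ p) ℤ.* a , (+ p) ℤ.* b ⟩
      p-scale a b = trans (cong (_* ⟨ a , b ⟩) (fromℤ≡⟨⟩ (+ p))) (trans (⟨⟩-* (+ p) ℤ.0ℤ a b)
        (cong₂ ⟨_,_⟩ (re₀ M (+ p) a b) (im₀ (+ p) a b)))
        where
        re₀ : ∀ M p a b → p ℤ.* a ℤ.+ M ℤ.* (ℤ.0ℤ ℤ.* b) ≡ p ℤ.* a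
        re₀ = ℤSolver.solve-∀
        im₀ : ∀ p a b → p ℤ.* b ℤ.+ ℤ.0ℤ ℤ.* a ℤ.+ ℤ.0ℤ ℤ.* b ≡ p ℤ.* b
        im₀ = ℤSolver.solve-∀

    𝔭 : FractionalIdeal
    𝔭 = record
      { ideal = Lattice p
      ; inverse = Colon
      ; ideal-isSubmodule = Lattice-isSubmodule c M≡cp
      ; inverse-isSubmodule = record
        { 0∈ = λ x x∈ → 0∈ (colon ℤ[ω]-isSubmodule x)
        ; +-closed = λ p q x x∈ → +-closed (colon ℤ[ω]-isSubmodule x) (p x x∈) (q x x∈)
        ; ·-closed = λ a p x x∈ → ·-closed (colon ℤ[ω]-isSubmodule x) a (p x x∈) }
      ; ideal·inverse
        = ·-least Span-isSubmodule (λ x∈ y∈ → proj₂ unitIdeal≐ℤ[ω] (y∈ _ x∈))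
        , Span-least Span-isSubmodule (λ { refl → subst (Lattice p · Colon) 1≡
            (add (gen· (m∈Lattice p) ω̄/p∈Colon) (gen· (ω∈Lattice p) 1∈Colon)) }) }
      where
      1≡ : fromℤ (+ p) * (ι 1/p * ω̄) + ω * 1# ≡ 1#
      1≡ = begin
        fromℤ (+ p) * (ι 1/p * ω̄) + ω * 1#   ≡⟨ cong₂ _+_ (sym (*-assoc (fromℤ (+ p)) (ι 1/p) ω̄)) (*-identityʳ ω) ⟩
        fromℤ (+ p) * ι 1/p * ω̄ + ω          ≡⟨ cong (λ x → x * ω̄ + ω) p*1/p ⟩
        1# * ω̄ + ω                           ≡⟨ cong (λ x → x + ω) (*-identityˡ ω̄) ⟩
        ω̄ + ω                                ≡⟨ ⟨⟩-+ ℤ.1ℤ ℤ.-1ℤ ℤ.0ℤ ℤ.1ℤ ⟩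
        ⟨ ℤ.1ℤ , ℤ.0ℤ ⟩                      ≡⟨ sym (fromℤ≡⟨⟩ ℤ.1ℤ) ⟩
        1#                                   ∎

    open Mult (AbelianGroup.monoid ClassGroup) using () renaming (_×_ to _⋆_)

    -- ω ∈ 𝔭 ∙ 𝔭ˢ because ω = ω² - M.
    Lattice-product : ∀ m c′ → M ≡ c′ ℤ.* + (p ℕ.* m) → Lattice p · Lattice m ≐ Lattice (p ℕ.* m)
    Lattice-product m c′ M≡c′pm = ·-least (Lattice-isSubmodule c′ M≡c′pm) product , generated
      where
      +pm≡ : + (p ℕ.* m) ≡ (+ p) ℤ.* (+ m)
      +pm≡ = ℤ.pos-* p m

      M≡ : M ≡ c′ ℤ.* ((+ p) ℤ.* (+ m))
      M≡ = trans M≡c′pm (cong (c′ ℤ.*_) +pm≡)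

      product : ∀ {x y} → Lattice p x → Lattice m y → Lattice (p ℕ.* m) (x * y)
      product (k , v , refl) (k′ , v′ , refl) = k ℤ.* k′ ℤ.+ c′ ℤ.* (v ℤ.* v′) , _ ,
        trans (⟨⟩-* (k ℤ.* + p) v (k′ ℤ.* + m) v′) (cong ⟨_, _ ⟩
          (trans (cong (λ M → k ℤ.* + p ℤ.* (k′ ℤ.* + m) ℤ.+ M ℤ.* (v ℤ.* v′)) M≡)
            (trans (factor k (+ p) k′ (+ m) c′ v v′) (cong ((k ℤ.* k′ ℤ.+ c′ ℤ.* (v ℤ.* v′)) ℤ.*_) (sym +pm≡)))))
        where
        factor : ∀ k p k′ m c v v′ → k ℤ.* p ℤ.* (k′ ℤ.* m) ℤ.+ c ℤ.* (p ℤ.* m) ℤ.* (v ℤ.* v′)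
          ≡ (k ℤ.* k′ ℤ.+ c ℤ.* (v ℤ.* v′)) ℤ.* (p ℤ.* m)
        factor = ℤSolver.solve-∀

      generated : ∀ {z} → Lattice (p ℕ.* m) z → (Lattice p · Lattice m) z
      -- Here kpm + vω = (k - v c′) pm + v ω²: the surplus v M in v ω² is the v c′ pm taken off.
      generated (k , v , refl) = subst (Lattice p · Lattice m) z≡
        (add (scalar (fromℤ-integral (k ℤ.- v ℤ.* c′)) (gen· (m∈Lattice p) (m∈Lattice m)))
          (scalar (fromℤ-integral v) (gen· (ω∈Lattice p) (ω∈Lattice m))))
        where
        re≡ : ∀ M k v c′ pm → M ≡ c′ ℤ.* pm →
          ((k ℤ.- v ℤ.* c′) ℤ.* pm ℤ.+ M ℤ.* (ℤ.0ℤ ℤ.* ℤ.0ℤ)) ℤ.+ (v ℤ.* M ℤ.+ M ℤ.* (ℤ.0ℤ ℤ.* ℤ.1ℤ)) ≡ k ℤ.* pm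
        re≡ _ k v c′ pm refl = eq k v c′ pm
          where
          eq : ∀ k v c′ pm → ((k ℤ.- v ℤ.* c′) ℤ.* pm ℤ.+ c′ ℤ.* pm ℤ.* (ℤ.0ℤ ℤ.* ℤ.0ℤ))
            ℤ.+ (v ℤ.* (c′ ℤ.* pm) ℤ.+ c′ ℤ.* pm ℤ.* (ℤ.0ℤ ℤ.* ℤ.1ℤ)) ≡ k ℤ.* pm
          eq = ℤSolver.solve-∀
        im≡ : ∀ M j pm v → (j ℤ.* ℤ.0ℤ ℤ.+ ℤ.0ℤ ℤ.* pm ℤ.+ ℤ.0ℤ ℤ.* ℤ.0ℤ)
          ℤ.+ (v ℤ.* ℤ.1ℤ ℤ.+ ℤ.0ℤ ℤ.* M ℤ.+ ℤ.0ℤ ℤ.* ℤ.1ℤ) ≡ v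
        im≡ = ℤSolver.solve-∀
        ω²≡ : ω * ω ≡ ⟨ M , ℤ.1ℤ ⟩
        ω²≡ = trans (⟨⟩-* ℤ.0ℤ ℤ.1ℤ ℤ.0ℤ ℤ.1ℤ) (cong ⟨_, ℤ.1ℤ ⟩ (eq M))
          where
          eq : ∀ M → ℤ.0ℤ ℤ.* ℤ.0ℤ ℤ.+ M ℤ.* (ℤ.1ℤ ℤ.* ℤ.1ℤ) ≡ M
          eq = ℤSolver.solve-∀
        j : ℤ
        j = k ℤ.- v ℤ.* c′
        z≡ : fromℤ j * (fromℤ (+ p) * fromℤ (+ m)) + fromℤ v * (ω * ω) ≡ ⟨ k ℤ.* + (p ℕ.* m) , v ⟩
        z≡ = begin
          fromℤ j * (fromℤ (+ p) * fromℤ (+ m)) + fromℤ v * (ω * ω)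
            ≡⟨ cong₂ (λ x y → fromℤ j * x + fromℤ v * y)
                 (trans (sym (fromℤ-* (+ p) (+ m))) (trans (cong fromℤ (sym +pm≡)) (fromℤ≡⟨⟩ (+ (p ℕ.* m))))) ω²≡ ⟩
          fromℤ j * ⟨ + (p ℕ.* m) , ℤ.0ℤ ⟩ + fromℤ v * ⟨ M , ℤ.1ℤ ⟩
            ≡⟨ cong₂ (λ x y → x * ⟨ + (p ℕ.* m) , ℤ.0ℤ ⟩ + y * ⟨ M , ℤ.1ℤ ⟩) (fromℤ≡⟨⟩ j) (fromℤ≡⟨⟩ v) ⟩
          ⟨ j , ℤ.0ℤ ⟩ * ⟨ + (p ℕ.* m) , ℤ.0ℤ ⟩ + ⟨ v , ℤ.0ℤ ⟩ * ⟨ M , ℤ.1ℤ ⟩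
            ≡⟨ cong₂ _+_ (⟨⟩-* j ℤ.0ℤ (+ (p ℕ.* m)) ℤ.0ℤ) (⟨⟩-* v ℤ.0ℤ M ℤ.1ℤ) ⟩
          _ ≡⟨ ⟨⟩-+ _ _ _ _ ⟩
          _ ≡⟨ cong₂ ⟨_,_⟩ (re≡ M k v c′ (+ (p ℕ.* m)) M≡c′pm) (im≡ M j (+ (p ℕ.* m)) v) ⟩
          ⟨ k ℤ.* + (p ℕ.* m) , v ⟩ ∎

    -- An equality of ideals and not just of classes, since `_⋆_` multiplies representatives. In the
    -- induction, a cofactor c′ of p^(s+1) in M becomes the cofactor c′ p of p^s.
    𝔭-power : ∀ s c′ → M ≡ c′ ℤ.* + (p ℕ.^ s) → ideal (s ⋆ 𝔭) ≐ Lattice (p ℕ.^ s)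
    𝔭-power zero c′ _ = ≐-trans unitIdeal≐ℤ[ω]
      ( (λ { (u , v , refl) → u , v , cong ⟨_, v ⟩ (sym (ℤ.*-identityʳ u)) })
      , (λ { (k , v , refl) → k ℤ.* ℤ.1ℤ , v , refl }) )
    𝔭-power (suc s) c′ M≡ = ≐-trans
      (·-cong ≐-refl (𝔭-power s (c′ ℤ.* + p)
        (trans M≡ (trans (cong (c′ ℤ.*_) (ℤ.pos-* p (p ℕ.^ s))) (sym (ℤ.*-assoc c′ (+ p) (+ (p ℕ.^ s))))))))
      (Lattice-product (p ℕ.^ s) c′ M≡)

    -- Equivalence to `1ᴵ` provides a generator x. It lies in the lattice as x times 1, and the
    -- lattice elements p^s and ω are multiples of x by elements of ℤ[ω]; comparing coordinates
    -- gives the integer equations of `Generates`.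
    principal⇒generated : ∀ s c′ → M ≡ c′ ℤ.* + (p ℕ.^ s) → (s ⋆ 𝔭) ∼ 1ᴵ → ∃₂ λ u v → Generates M (p ℕ.^ s) u v
    principal⇒generated s c′ M≡ (x , _ , 𝔭ˢ⊆x , x⊆𝔭ˢ) =
      extract (proj₁ power (x⊆𝔭ˢ (1# , gen refl , sym (*-identityʳ x))))
              (divides-by (m∈Lattice (p ℕ.^ s))) (divides-by (ω∈Lattice (p ℕ.^ s)))
      where
      power : ideal (s ⋆ 𝔭) ≐ Lattice (p ℕ.^ s)
      power = 𝔭-power s c′ M≡

      divides-by : ∀ {z} → Lattice (p ℕ.^ s) z → ∃₂ λ a b → z ≡ x * ⟨ a , b ⟩
      divides-by z∈ =
        let y , y∈ , z≡xy = 𝔭ˢ⊆x (proj₂ power z∈)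
            a , b , y≡ = proj₁ unitIdeal≐ℤ[ω] y∈
        in a , b , trans z≡xy (cong (x *_) y≡)

      extract : Lattice (p ℕ.^ s) x → (∃₂ λ a b → fromℤ (+ (p ℕ.^ s)) ≡ x * ⟨ a , b ⟩) →
                (∃₂ λ e f → ω ≡ x * ⟨ e , f ⟩) →
                ∃₂ λ u v → Generates M (p ℕ.^ s) u v
      extract (k , v , x≡) (a , b , m≡) (e , f , ω≡) = k ℤ.* + (p ℕ.^ s) , v , record
        { k = k ; a = a ; b = b ; e = e ; f = f
        ; u≡km = refl
        ; re-m = proj₁ m-coordinates
        ; im-m = proj₂ m-coordinates
        ; re-ω = proj₁ ω-coordinates
        ; im-ω = proj₂ ω-coordinates }
        where
        u : ℤ
        u = k ℤ.* + (p ℕ.^ s)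

        coordinates : ∀ a b {i j} → ⟨ i , j ⟩ ≡ x * ⟨ a , b ⟩ →
          u ℤ.* a ℤ.+ M ℤ.* (v ℤ.* b) ≡ i × u ℤ.* b ℤ.+ v ℤ.* a ℤ.+ v ℤ.* b ≡ j
        coordinates a b e = ⟨⟩-injective (trans (sym (⟨⟩-* u v a b)) (trans (cong (_* ⟨ a , b ⟩) (sym x≡)) (sym e)))

        m-coordinates = coordinates a b (trans (sym (fromℤ≡⟨⟩ (+ (p ℕ.^ s)))) m≡)
        ω-coordinates = coordinates e f ω≡

-- A nontrivial multiple of the class of 𝔭

open import Data.Nat.Base using (_+_; _*_; _^_)

theorem6p1 : ∀ (p t n d q r : ℕ) → Prime p → p ≢ 2 → 1 ≤ t → n ≡ 2 * p ^ t →
    d ≡ n ^ 2 + 1 → SquareFree d →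
    Prime q → 2 ≤ r → QuadraticField.ClassNumber (+ d) (q ^ r) →
    q ^ (r ∸ 1) < t →
    QuadraticField.ClassGroup (+ d) ≅ ℤ/ (q ^ r) ℤ
theorem6p1 p t n d q (suc k) p-prime _ _ refl refl squarefree q-prime _ order s<t =
  prime-power-order⇒cyclic (QuadraticField.ClassGroup (+ d)) q-prime k order 𝔭 𝔭ˢ≁1
  where
  instance
    _ = prime⇒nonZero p-prime
    _ = prime⇒nonZero q-prime
    _ = prime⇒nonTrivial p-prime

  s Q : ℕ
  s = q ^ k
  Q = p ^ t

  M : ℤ
  M = + Q ℤ.* + Q

  d≡4M+1 : + d ≡ (+ 4) ℤ.* M ℤ.+ ℤ.1ℤ
  d≡4M+1 = trans (ℤ.pos-+ (n ^ 2) 1) (cong (ℤ._+ ℤ.1ℤ) (trans (cong +_ (ℕ-square Q))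
    (trans (ℤ.pos-* 4 (Q * Q)) (cong ((+ 4) ℤ.*_) (ℤ.pos-* Q Q)))))
    where
    ℕ-square : ∀ Q → 2 * Q * (2 * Q * 1) ≡ 4 * (Q * Q)
    ℕ-square = ℕSolver.solve-∀

  p^∣M : ∀ j → j ≤ t → ∃ λ c → M ≡ c ℤ.* + (p ^ j)
  p^∣M j j≤t = + Q ℤ.* + (p ^ (t ∸ j)) , trans (cong (λ y → + Q ℤ.* + y) Q≡)
    (trans (cong (+ Q ℤ.*_) (ℤ.pos-* (p ^ (t ∸ j)) (p ^ j))) (sym (ℤ.*-assoc (+ Q) _ _)))
    where
    Q≡ : Q ≡ p ^ (t ∸ j) * p ^ j
    Q≡ = trans (cong (p ^_) (sym (ℕ.m∸n+n≡m j≤t))) (ℕ.^-distribˡ-+-* p (t ∸ j) j)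

  1≤s : 1 ≤ s
  1≤s = ℕ.m^n>0 q k

  -- `c₁` makes ℤp + ℤω an ideal; `cₛ` does the same for the lattice of its s-th power.
  c₁ = p^∣M 1 (ℕ.≤-trans 1≤s (ℕ.<⇒≤ s<t))
  cₛ = p^∣M s (ℕ.<⇒≤ s<t)

  open QuadraticField (+ d) using (ClassGroup)
  open Mult (AbelianGroup.monoid ClassGroup) using () renaming (_×_ to _⋆_)
  open RingOfIntegers d M d≡4M+1 squarefree
  open PrimeIdeal p (proj₁ c₁) (trans (proj₂ c₁) (cong (λ y → proj₁ c₁ ℤ.* + y) (ℕ.*-identityʳ p)))
  open Descent Q using (not-generated)

  p^s>1 : 2 ≤ p ^ s
  p^s>1 = ℕ.≤-trans (ℕ.nonTrivial⇒n>1 p) (ℕ.≤-trans (ℕ.≤-reflexive (sym (ℕ.*-identityʳ p))) (ℕ.^-monoʳ-≤ p 1≤s))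

  -- The strictness of q^(r-1) < t matters here: the descent needs generators of norm below Q = n /
  -- 2.
  p^s<Q : p ^ s < Q
  p^s<Q = ℕ.^-monoʳ-< p (ℕ.nonTrivial⇒n>1 p) s<t

  𝔭ˢ≁1 : ¬ AbelianGroup._≈_ ClassGroup (s ⋆ 𝔭) (AbelianGroup.ε ClassGroup)
  𝔭ˢ≁1 principal =
    let u , v , g = principal⇒generated s (proj₁ cₛ) (proj₂ cₛ) principal
    in not-generated (ℕ.<⇒≤ p^s>1) p^s<Q p^s>1 (proj₁ cₛ) (proj₂ cₛ) g
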